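{- For every $b\ge 1000$ and $n\ge\lfloor 3\sqrt{b}\rfloor+1$ (with $b,n\in\mathbb{N}$) the following holds. There exist a function $g:\{0,1\}^b\times\{0,1\}^b\to\{0,1\}$ with $\Delta(g)\in\Theta(\sqrt{b})$ (with universal implied constants) and two independent random variables $X,Y$ over $(\{0,1\}^b)^n$ that are $\frac{2}{\Delta(g)}$-sparse such that every $x\in\mathrm{supp}(X)$ is $2$-dangerous for $Y$ (where dangerousness is measured with $\sigma_Y=\frac{2}{\Delta(g)}$).
   Context: All logarithms are base 2. Write $\Lambda=\{0,1\}^b$, $[n]=\{1,\dots,n\}$; for $x\in\Lambda^n$ and $I\subseteq[n]$, $x_I\in\Lambda^I$ is the projection to the coordinates in $I$, and $g^I:\Lambda^I\times\Lambda^I\to\{0,1\}^I$ applies $g$ to each of the $|I|$ pairs. Discrepancy: let $U,V$ be independent and uniform over $\Lambda$. For a combinatorial rectangle $R\subseteq\Lambda\times\Lambda$, $\mathrm{disc}_R(g)=\left|\Pr[g(U,V)=0\wedge(U,V)\in R]-\Pr[g(U,V)=1\wedge(U,V)\in R]\right|$; $\mathrm{disc}(g)=\max_R\mathrm{disc}_R(g)$ and $\Delta=\Delta(g)=\log\frac{1}{\mathrm{disc}(g)}$. Deficiency and sparsity: for a random variable $V$ with values in a finite set $\mathcal{V}$, $D_\infty(V)=\log|\mathcal{V}|-H_\infty(V)$, where $H_\infty$ is min-entropy. For $\sigma>0$, a random variable $X$ with values in $\Lambda^n$ is $\sigma$-sparse if $D_\infty(X_S)\le\sigma\cdot\Delta\cdot|S|$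 for every $S\subseteq[n]$; similarly for random variables with values in $\Lambda^{[n]-I}$. Dangerous values: let $Y$ be a random variable with values in $\Lambda^n$. A value $x\in\Lambda^n$ is leaking if there exist $I\subseteq[n]$ and $z_I\in\{0,1\}^I$ such that $\Pr[g^I(x_I,Y_I)=z_I]<2^{ -|I|-1}$. Let $\sigma_Y,\varepsilon>0$ and suppose $Y$ is $\sigma_Y$-sparse. A value $x\in\Lambda^n$ is $\varepsilon$-sparsifying if there exist $I\subseteq[n]$ and $z_I\in\{0,1\}^I$ such that the random variable $Y_{[n]-I}$ conditioned on $g^I(x_I,Y_I)=z_I$ is not $(\sigma_Y+\varepsilon)$-sparse. A value $x$ is $\varepsilon$-dangerous if it is leaking or $\varepsilon$-sparsifying. -}

module Defs where

open import Data.Bool.Base using (Bool; true; false; not; _∧_; if_then_else_)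
import Data.Bool.Properties as Bool
open import Data.Fin.Base using (Fin)
open import Data.Fin.Subset using (Subset; inside; outside; ∣_∣; ∁)
open import Data.Integer.Base using (ℤ; +_; -[1+_])
open import Data.List.Base using (List; []; _∷_; map; length; cartesianProduct;
  cartesianProductWith; filterᵇ)
open import Data.Nat.Base as ℕ using (ℕ; zero; suc)
import Data.Nat.Properties as ℕ
open import Data.Product.Base using (Σ-syntax; ∃-syntax; _×_; _,_; uncurry)
open import Data.Rational.Base using (ℚ; 0ℚ; 1ℚ; ½; _/_; 1/_; -_; _+_; _-_; _*_;
  _≤_; _<_; ↥_; ↧ₙ_; NonZero; Positive; NonNegative; positive; nonNegative)
  renaming (∣_∣ to abs)
open import Data.Rational.Properties using (≤-decTotalOrder; ≤-refl; +-*-commutativeRing;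
  pos⇒nonZero; 1/pos⇒pos; pos⇒nonNeg; nonNeg*nonNeg⇒nonNeg; nonNegative⁻¹;
  *-inverseʳ)
open import Data.Sum.Base using (_⊎_)
open import Data.Vec.Base using (Vec; []; _∷_; zipWith)
open import Data.Vec.Properties using (≡-dec)
open import Relation.Binary.Bundles using (DecTotalOrder)
open import Algebra.Bundles using (CommutativeRing)
open import Data.List.Extrema (DecTotalOrder.totalOrder ≤-decTotalOrder) using (max)
open import Algebra.Properties.Semiring.Sum (CommutativeRing.semiring +-*-commutativeRing)
  using (sum; *-distribʳ-sum)
open import Algebra.Properties.Semiring.Exp (CommutativeRing.semiring +-*-commutativeRing)
  using (_^_)
open import Relation.Binary.Definitions using (DecidableEquality)
open import Relation.Binary.PropositionalEquality using (_≡_; sym; trans)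
open import Relation.Nullary using (¬_; does)

------------------------------------------------------------------------
-- Real numbers

-- A real x is represented by its Dedekind cut: lower q means q < x and
-- upper q means x < q.  The cut axioms are not bundled; they hold
-- for fromℚ, √_ and log of a positive rational, and the operations (which are
-- the usual interval-arithmetic ones on Dedekind cuts) preserve them.  For cuts
-- satisfying the axioms, ¬ (y < x) is equivalent to the inclusion of lower cuts.

record Cut : Set₁ where
  constructor cut
  field
    lower : ℚ → Set
    upper : ℚ → Set

open Cut public

infix  4 _<ʳ_ _≤ʳ_
infixl 6 _+ʳ_ _-ʳ_
infixl 7 _*ʳ_ _/ʳ_
infix  8 -ʳ_

_<ʳ_ : Cut → Cut → Set
x <ʳ y = ∃[ q ] (upper x q × lower y q)

_≤ʳ_ : Cut → Cut → Set
x ≤ʳ y = ¬ (y <ʳ x)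

fromℚ : ℚ → Cut
fromℚ p = cut (λ q → q < p) (λ q → p < q)

fromℕ : ℕ → Cut
fromℕ n = fromℚ (+ n / 1)

_+ʳ_ : Cut → Cut → Cut
x +ʳ y = cut
  (λ q → ∃[ a ] ∃[ c ] (lower x a × lower y c × q < a + c))
  (λ q → ∃[ a ] ∃[ c ] (upper x a × upper y c × a + c < q))

-ʳ_ : Cut → Cut
-ʳ x = cut (λ q → upper x (- q)) (λ q → lower x (- q))

_-ʳ_ : Cut → Cut → Cut
x -ʳ y = x +ʳ (-ʳ y)

-- q is below (above) x * y iff it is below (above) all four corners of some
-- rational box a < x < b, c < y < d.
_*ʳ_ : Cut → Cut → Cut
x *ʳ y = cut
  (λ q → box (λ p → q < p))
  (λ q → box (λ p → p < q))
  where
  box : (ℚ → Set) → Set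
  box Q = ∃[ a ] ∃[ b ] ∃[ c ] ∃[ d ]
    ( lower x a × upper x b × lower y c × upper y d
    × Q (a * c) × Q (a * d) × Q (b * c) × Q (b * d))

-- The quotient, for a positive divisor y only: q < 1 / y iff q * r < 1 for some
-- r > y, and 1 / y < q iff 1 < q * r for some r with 0 < r < y.
_/ʳ_ : Cut → Cut → Cut
x /ʳ y = x *ʳ recip
  where
  recip : Cut
  recip = cut
    (λ q → ∃[ r ] (0ℚ < r × upper y r × q * r < 1ℚ))
    (λ q → ∃[ r ] (0ℚ < r × lower y r × 1ℚ < q * r))

√_ : ℕ → Cut
√ n = cut
  (λ q → q < 0ℚ ⊎ q * q < + n / 1)
  (λ q → 0ℚ < q × + n / 1 < q * q)

2^_ : ℤ → ℚ
2^ (+ n)      = (+ 2 / 1) ^ n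
2^ -[1+ n ]   = ½ ^ suc n

-- The binary logarithm of a positive rational p: for q = u / d in lowest terms,
-- q < log p iff 2 ^ u < p ^ d.
log : ℚ → Cut
log p = cut
  (λ q → 2^ (↥ q) < p ^ (↧ₙ q))
  (λ q → p ^ (↧ₙ q) < 2^ (↥ q))

_IsFloorOf_ : ℕ → Cut → Set
k IsFloorOf x = fromℕ k ≤ʳ x × x <ʳ fromℕ (k ℕ.+ 1)

------------------------------------------------------------------------
-- Finite probability spaces

-- Probabilities are rational.
record ProbSpace : Set where
  field
    size      : ℕ
    weight    : Fin size → ℚ
    weight≥0  : ∀ ω → 0ℚ ≤ weight ω
    total     : sum weight ≡ 1ℚ

open ProbSpace public

RV : ProbSpace → Set → Set
RV P A = Fin (size P) → A

Event : ProbSpace → Set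
Event P = RV P Bool

restrict : (P : ProbSpace) → Event P → Fin (size P) → ℚ
restrict P E ω = if E ω then weight P ω else 0ℚ

Pr : (P : ProbSpace) → Event P → ℚ
Pr P E = sum (restrict P E)

condition : (P : ProbSpace) (E : Event P) → 0ℚ < Pr P E → ProbSpace
condition P E pos = record
  { size     = size P
  ; weight   = λ ω → restrict P E ω * inv
  ; weight≥0 = λ ω → nonNegative⁻¹ _
      {{nonNeg*nonNeg⇒nonNeg (restrict P E ω) {{nonNegative (restrict≥0 ω)}} inv}}
  ; total    = trans (sym (*-distribʳ-sum inv (restrict P E))) (*-inverseʳ (Pr P E))
  }
  where
  instance
    Pr-pos : Positive (Pr P E)
    Pr-pos = positive pos

    Pr-nonZero : NonZero (Pr P E)
    Pr-nonZero = pos⇒nonZero (Pr P E)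

  inv : ℚ
  inv = 1/ Pr P E

  instance
    inv-nonNeg : NonNegative inv
    inv-nonNeg = pos⇒nonNeg inv {{1/pos⇒pos (Pr P E)}}

  restrict≥0 : ∀ ω → 0ℚ ≤ restrict P E ω
  restrict≥0 ω with E ω
  ... | true  = weight≥0 P ω
  ... | false = ≤-refl

------------------------------------------------------------------------
-- Strings over Λ = {0,1}^b

Λ : ℕ → Set
Λ b = Vec Bool b

_≟ᵇ_ : ∀ {m} → DecidableEquality (Vec Bool m)
_≟ᵇ_ = ≡-dec Bool._≟_

_≟ˢ_ : ∀ {b m} → DecidableEquality (Vec (Λ b) m)
_≟ˢ_ = ≡-dec _≟ᵇ_

allVecs : ∀ {A : Set} → List A → ∀ m → List (Vec A m)
allVecs xs zero    = [] ∷ []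
allVecs xs (suc m) = cartesianProductWith _∷_ xs (allVecs xs m)

allΛ : ∀ b → List (Λ b)
allΛ = allVecs (false ∷ true ∷ [])

-- x_I, where A^I is represented by vectors of length ∣ I ∣, the coordinates in I
-- being listed in increasing order.
project : ∀ {A : Set} {n} (I : Subset n) → Vec A n → Vec A ∣ I ∣
project []            []       = []
project (inside  ∷ I) (x ∷ xs) = x ∷ project I xs
project (outside ∷ I) (x ∷ xs) = project I xs

------------------------------------------------------------------------
-- Discrepancy

Gadget : ℕ → Set
Gadget b = Λ b → Λ b → Bool

-- The probability of an event about independent uniform U, V over Λ.
PrUV : ∀ {b} → (Λ b → Λ b → Bool) → ℚ
PrUV {b} E =
  (+ length (filterᵇ (uncurry E) (cartesianProduct (allΛ b) (allΛ b)))
    / (2 ℕ.^ b ℕ.* 2 ℕ.^ b))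
    {{ℕ.m*n≢0 (2 ℕ.^ b) (2 ℕ.^ b) {{ℕ.m^n≢0 2 b}} {{ℕ.m^n≢0 2 b}}}}

-- A rectangle A × B is given by the indicator functions of A and B.
Rectangle : ℕ → Set
Rectangle b = (Λ b → Bool) × (Λ b → Bool)

discOn : ∀ {b} → Gadget b → Rectangle b → ℚ
discOn g (A , B) = abs
  ( PrUV (λ u v → not (g u v) ∧ (A u ∧ B v))
  - PrUV (λ u v → g u v       ∧ (A u ∧ B v)))

-- All subsets of {0,1}^b: a subset of {0,1}^(b+1) amounts to two subsets of
-- {0,1}^b, one for each value of the first bit.
allPredicates : ∀ b → List (Λ b → Bool)
allPredicates zero    = (λ _ → false) ∷ (λ _ → true) ∷ []
allPredicates (suc b) = cartesianProductWith split (allPredicates b) (allPredicates b)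
  where
  split : (Λ b → Bool) → (Λ b → Bool) → Λ (suc b) → Bool
  split p q (false ∷ v) = p v
  split p q (true  ∷ v) = q v

disc : ∀ {b} → Gadget b → ℚ
disc {b} g = max 0ℚ (map (discOn g) (cartesianProduct (allPredicates b) (allPredicates b)))

-- log (1 / disc g)
Δ : ∀ {b} → Gadget b → Cut
Δ g = -ʳ log (disc g)

------------------------------------------------------------------------
-- Min-entropy, deficiency and sparsity

module _ {b m : ℕ} (P : ProbSpace) (V : RV P (Vec (Λ b) m)) where

  Pr[_] : Vec (Λ b) m → ℚ
  Pr[ v ] = Pr P (λ ω → does (V ω ≟ˢ v))

  -- min over v of log (1 / Pr[V = v])
  H∞ : Cut
  H∞ = -ʳ log (max 0ℚ (map Pr[_] (allVecs (allΛ b) m)))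

  D∞ : Cut
  D∞ = log (+ length (allVecs (allΛ b) m) / 1) -ʳ H∞

  _∈supp : Vec (Λ b) m → Set
  v ∈supp = 0ℚ < Pr[ v ]

-- For values in Λ^([n]-I), take m = ∣ ∁ I ∣: subsets of [n]-I correspond to
-- subsets of the ∣ ∁ I ∣ coordinates kept by project (∁ I).
Sparse : ∀ {b m} → Gadget b → Cut → (P : ProbSpace) → RV P (Vec (Λ b) m) → Set
Sparse {b} {m} g σ P V = (S : Subset m) →
  D∞ P (λ ω → project S (V ω)) ≤ʳ σ *ʳ Δ g *ʳ fromℕ ∣ S ∣

Independent : ∀ {b m n} (P : ProbSpace) →
  RV P (Vec (Λ b) m) → RV P (Vec (Λ b) n) → Set
Independent P X Y = ∀ x y →
  Pr P (λ ω → does (X ω ≟ˢ x) ∧ does (Y ω ≟ˢ y)) ≡ Pr[_] P X x * Pr[_] P Y y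

------------------------------------------------------------------------
-- Dangerous values

module _ {b n : ℕ} (g : Gadget b) (P : ProbSpace) (Y : RV P (Vec (Λ b) n)) where

  -- The event g^I(x_I, Y_I) = z
  gᴵ≡ : Vec (Λ b) n → (I : Subset n) → Vec Bool ∣ I ∣ → Event P
  gᴵ≡ x I z ω = does (zipWith g (project I x) (project I (Y ω)) ≟ᵇ z)

  Leaking : Vec (Λ b) n → Set
  Leaking x = ∃[ I ] ∃[ z ] Pr P (gᴵ≡ x I z) < 2^ -[1+ ∣ I ∣ ]

  -- The conditioning event must have positive probability; if it has
  -- probability zero then x is leaking anyway.
  Sparsifying : Cut → Cut → Vec (Λ b) n → Set
  Sparsifying σ ε x = ∃[ I ] ∃[ z ] Σ[ pos ∈ 0ℚ < Pr P (gᴵ≡ x I z) ]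
    ¬ Sparse g (σ +ʳ ε) (condition P (gᴵ≡ x I z) pos) (λ ω → project (∁ I) (Y ω))

  Dangerous : Cut → Cut → Vec (Λ b) n → Set
  Dangerous σ ε x = Leaking x ⊎ Sparsifying σ ε x

{-# OPTIONS --safe #-}
module Submission where

-- Let 100 s² ≤ b < 100 (s + 1)² and t = 2 s.  The gadget is
-- g (x₀ ∷ x) (y₀ ∷ y) = y₀ + ⟨ x , y ⟩ mod 2, where the inner product uses only
-- the first t coordinates.  Parseval's identity gives disc g ≤ 2^-s, and the
-- rectangle { y₀ = 0 } gives disc g ≥ 2^-(2s+1), so Δ g is of order √b.
--
-- X is uniform.  The first block of Y is uniform and is read as a list of
-- equations g (x_i , Y_i) = z_i, for i up to 30 s; each equation takes 1 + t bits
-- and all of them fit into b bits.  The i-th later block of Y is uniform subject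
-- to the i-th equation, which fixes one bit, so Y has deficiency at most one per
-- block.  Given any x, let I consist of the 30 s blocks after the first and choose
-- z with Pr[g^I(x_I , Y_I) = z] ≤ 2^-|I|.  One value of the first block spells out
-- exactly these equations and so forces the event; hence conditioning on the event
-- multiplies the probability of that value by at least 2^(30 s), which is more than
-- (2 / Δ + 2)-sparsity permits.

open import Defs
open import Data.Bool.Base using (Bool; true; false; not; _∧_; _xor_; if_then_else_)
open import Data.Bool.Properties as Bool using (xor-assoc; xor-same; xor-identityʳ)
open import Data.Fin.Subset using (Subset; inside; outside; ∁; ⊥) renaming (∣_∣ to card)
open import Data.Fin.Subset.Properties using (∣⊥∣≡0)
open import Data.Integer.Base as ℤ using (ℤ; +_; -[1+_])
import Data.Integer.Properties as ℤ
import Data.Integer.Tactic.RingSolver as ℤ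
open import Data.List.Base as List using (List; []; _∷_; _++_; length;
  cartesianProduct; cartesianProductWith; filterᵇ)
open import Data.List.Membership.Propositional using (_∈_)
open import Data.List.Membership.Propositional.Properties
  using (∈-map⁺; ∈-cartesianProductWith⁺; ∈-cartesianProduct⁺)
open import Data.List.Properties using (length-++; length-map; length-replicate; ++-assoc)
import Data.List.Relation.Unary.All as All
import Data.List.Relation.Unary.All.Properties as All
open import Data.List.Relation.Unary.Any using (here; there)
open import Data.Maybe.Base using (Maybe; just; nothing)
open import Data.Nat.Base as ℕ using (ℕ; zero; suc)
open import Data.Nat.Coprimality using (1-coprimeTo) renaming (sym to coprime-sym)
import Data.Nat.Properties as ℕ
open import Data.Nat.Tactic.RingSolver using (solve-∀)
open import Data.Product.Base using (Σ-syntax; ∃-syntax; _×_; _,_; proj₁; proj₂; uncurry)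
open import Data.Rational.Base
open import Data.Rational.Properties
open import Data.Rational.Solver using (module +-*-Solver)
open import Data.Sum.Base using (inj₁; inj₂)
open import Data.Unit.Base using (tt)
open import Data.Vec.Base as Vec using (Vec; []; _∷_; zipWith)
open import Data.Vec.Properties using (toList∘fromList)
open import Algebra.Bundles using (CommutativeRing)
open import Algebra.Properties.Semiring.Exp (CommutativeRing.semiring +-*-commutativeRing)
  using (_^_; ^-homo-*; ^-assocʳ)
open import Algebra.Properties.Semiring.Sum (CommutativeRing.semiring +-*-commutativeRing)
  using (sum; *-distribʳ-sum; sum-cong-≗)
open import Function.Base using (_∘_)
open import Relation.Binary.Bundles using (DecTotalOrder)
open import Data.List.Extrema (DecTotalOrder.totalOrder ≤-decTotalOrder)
  using (max; max≤v⁺; xs≤max; ⊥≤max)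
open import Relation.Binary.PropositionalEquality
  using (_≡_; refl; sym; trans; cong; cong₂; subst; subst₂; module ≡-Reasoning)
open import Relation.Nullary using (¬_; Dec; yes; no; does; contradiction)
open import Relation.Nullary.Decidable using (dec-true; from-yes)

open +-*-Solver using (solve; _:=_; _:+_; _:*_; _:-_; :-_; con)

-- The order √b is what this scheme can afford. Breaking (2 / Δ + 2)-sparsity on a single block
-- takes a deficiency of about 2 Δ, hence that many one-bit equations. Since Δ ≤ t + 1, each
-- equation has to name about Δ bits of x at least. So about Δ² bits must fit into one block of b
-- bits, and this is why the inner product is truncated to t coordinates.
--
-- Y is fixed before x, so its first block has to range over all systems of equations. The value z
-- is not free either: it is whatever happens to be rare. Keeping y₀ outside the inner product makes
-- every equation solvable for y₀, even when x_i is zero, at the cost of one bit.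
--
-- Constants: 10 s ≤ √b gives 30 s (2 s + 1) ≤ 90 s² ≤ b and 30 s ≤ 3 √b, so both the bits of one
-- block and the number of blocks suffice. The exact threshold for one block is 2 + 2 Δ ≤ 4 s + 4;
-- estimating the cut product through rational boxes gives only 20 s + 22, and 30 s is chosen to
-- exceed this cruder bound with room for rounding.

private variable
  A B C Q : Set
  b m n   : ℕ

-- Inequalities between rationals

*-monoˡ-≤ : ∀ {p q r} → 0ℚ ≤ r → p ≤ q → r * p ≤ r * q
*-monoˡ-≤ {r = r} 0≤r = *-monoˡ-≤-nonNeg r {{nonNegative 0≤r}}

*-monoʳ-≤ : ∀ {p q r} → 0ℚ ≤ r → p ≤ q → p * r ≤ q * r
*-monoʳ-≤ {r = r} 0≤r = *-monoʳ-≤-nonNeg r {{nonNegative 0≤r}}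

*-mono-≤ : ∀ {p q r s} → 0ℚ ≤ p → 0ℚ ≤ s → p ≤ q → r ≤ s → p * r ≤ q * s
*-mono-≤ 0≤p 0≤s p≤q r≤s = ≤-trans (*-monoˡ-≤ 0≤p r≤s) (*-monoʳ-≤ 0≤s p≤q)

*-nonNeg : ∀ {p q} → 0ℚ ≤ p → 0ℚ ≤ q → 0ℚ ≤ p * q
*-nonNeg {p} {q} 0≤p 0≤q = subst (_≤ p * q) (*-zeroʳ p) (*-monoˡ-≤ 0≤p 0≤q)

*-pos : ∀ {p q} → 0ℚ < p → 0ℚ < q → 0ℚ < p * q
*-pos {p} {q} 0<p 0<q = positive⁻¹ (p * q) {{pos*pos⇒pos p {{positive 0<p}} q {{positive 0<q}}}}

*-monoˡ-< : ∀ {p q r} → 0ℚ < r → p < q → r * p < r * q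
*-monoˡ-< {r = r} 0<r = *-monoʳ-<-pos r {{positive 0<r}}

*-monoʳ-< : ∀ {p q r} → 0ℚ < r → p < q → p * r < q * r
*-monoʳ-< {r = r} 0<r = *-monoˡ-<-pos r {{positive 0<r}}

*-cancelˡ-≤ : ∀ {p q r} → 0ℚ < r → r * p ≤ r * q → p ≤ q
*-cancelˡ-≤ {r = r} 0<r = *-cancelˡ-≤-pos r {{positive 0<r}}

square-nonNeg : ∀ p → 0ℚ ≤ p * p
square-nonNeg p with ≤-total 0ℚ p
... | inj₁ 0≤p = *-nonNeg 0≤p 0≤p
... | inj₂ p≤0 = subst (0ℚ ≤_)
  (solve 1 (λ p → (:- p) :* (:- p) := p :* p) refl p)
  (*-nonNeg (neg-antimono-≤ p≤0) (neg-antimono-≤ p≤0))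

^-nonNeg : ∀ {p} n → 0ℚ ≤ p → 0ℚ ≤ p ^ n
^-nonNeg zero    0≤p = <⇒≤ (positive⁻¹ 1ℚ)
^-nonNeg (suc n) 0≤p = *-nonNeg 0≤p (^-nonNeg n 0≤p)

^-mono-≤ : ∀ {p q} n → 0ℚ ≤ p → p ≤ q → p ^ n ≤ q ^ n
^-mono-≤ zero    0≤p p≤q = ≤-refl
^-mono-≤ (suc n) 0≤p p≤q =
  *-mono-≤ 0≤p (^-nonNeg n (≤-trans 0≤p p≤q)) p≤q (^-mono-≤ n 0≤p p≤q)

^-pos : ∀ {p} n → 0ℚ < p → 0ℚ < p ^ n
^-pos zero    0<p = positive⁻¹ 1ℚ
^-pos (suc n) 0<p = *-pos 0<p (^-pos n 0<p)

^-mono-< : ∀ {p q} n → 0ℚ ≤ p → p < q → p ^ suc n < q ^ suc n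
^-mono-< n 0≤p p<q = ≤-<-trans (*-monoˡ-≤ 0≤p (^-mono-≤ n 0≤p (<⇒≤ p<q)))
  (*-monoʳ-< (^-pos n (≤-<-trans 0≤p p<q)) p<q)

1^n≡1 : ∀ n → 1ℚ ^ n ≡ 1ℚ
1^n≡1 zero    = refl
1^n≡1 (suc n) = trans (*-identityˡ _) (1^n≡1 n)

-- Built in lowest terms, so that numerator and denominator reduce by computation, whereas `i / 1`
-- is stuck on a gcd.
⟦_⟧ : ℤ → ℚ
⟦ i ⟧ = mkℚ i 0 (coprime-sym (1-coprimeTo ℤ.∣ i ∣))

i/1≡⟦i⟧ : ∀ i → i / 1 ≡ ⟦ i ⟧
i/1≡⟦i⟧ i = ↥p/↧p≡p ⟦ i ⟧

⟦⟧-homo-+ : ∀ i j → ⟦ i ⟧ + ⟦ j ⟧ ≡ ⟦ i ℤ.+ j ⟧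
⟦⟧-homo-+ i j = trans
  (cong (_/ 1) (cong₂ ℤ._+_ (ℤ.*-identityʳ i) (ℤ.*-identityʳ j))) (i/1≡⟦i⟧ (i ℤ.+ j))

⟦⟧-homo-* : ∀ i j → ⟦ i ⟧ * ⟦ j ⟧ ≡ ⟦ i ℤ.* j ⟧
⟦⟧-homo-* i j = i/1≡⟦i⟧ (i ℤ.* j)

⟦⟧-homo-neg : ∀ i → - ⟦ i ⟧ ≡ ⟦ ℤ.- i ⟧
⟦⟧-homo-neg (+ zero)    = refl
⟦⟧-homo-neg ℤ.+[1+ n ] = refl
⟦⟧-homo-neg -[1+ n ]    = refl

⟦⟧-mono-≤ : ∀ {i j} → i ℤ.≤ j → ⟦ i ⟧ ≤ ⟦ j ⟧
⟦⟧-mono-≤ {i} {j} i≤j =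
  *≤* (subst₂ ℤ._≤_ (sym (ℤ.*-identityʳ i)) (sym (ℤ.*-identityʳ j)) i≤j)

⟦⟧-mono-< : ∀ {i j} → i ℤ.< j → ⟦ i ⟧ < ⟦ j ⟧
⟦⟧-mono-< {i} {j} i<j =
  *<* (subst₂ ℤ._<_ (sym (ℤ.*-identityʳ i)) (sym (ℤ.*-identityʳ j)) i<j)

⟦⟧-cancel-< : ∀ {i j} → ⟦ i ⟧ < ⟦ j ⟧ → i ℤ.< j
⟦⟧-cancel-< {i} {j} i<j =
  subst₂ ℤ._<_ (ℤ.*-identityʳ i) (ℤ.*-identityʳ j) (drop-*<* i<j)

ℕ-mono-≤ : ∀ {m n} → m ℕ.≤ n → ⟦ + m ⟧ ≤ ⟦ + n ⟧
ℕ-mono-≤ m≤n = ⟦⟧-mono-≤ (ℤ.+≤+ m≤n)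

-- Powers of two

2ℚ : ℚ
2ℚ = + 2 / 1

2^-suc : ∀ i → 2^ (ℤ.suc i) ≡ 2ℚ * 2^ i
2^-suc (+ n)          = refl
2^-suc -[1+ zero ]    = refl
2^-suc -[1+ suc n ] = sym (trans (sym (*-assoc 2ℚ ½ (½ ^ suc n))) (*-identityˡ _))

2^-pred : ∀ i → 2^ (ℤ.pred i) ≡ ½ * 2^ i
2^-pred i = begin
  2^ (ℤ.pred i)               ≡⟨ *-identityˡ _ ⟨
  1ℚ * 2^ (ℤ.pred i)          ≡⟨ *-assoc ½ 2ℚ (2^ (ℤ.pred i)) ⟩
  ½ * (2ℚ * 2^ (ℤ.pred i))    ≡⟨ cong (½ *_) (2^-suc (ℤ.pred i)) ⟨
  ½ * 2^ (ℤ.suc (ℤ.pred i))   ≡⟨ cong (λ j → ½ * 2^ j) (ℤ.suc-pred i) ⟩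
  ½ * 2^ i                    ∎
  where open ≡-Reasoning

2^-homo-+ : ∀ i j → 2^ (i ℤ.+ j) ≡ 2^ i * 2^ j
2^-homo-+ (+ zero) j = trans (cong 2^_ (ℤ.+-identityˡ j)) (sym (*-identityˡ _))
2^-homo-+ ℤ.+[1+ n ] j = begin
  2^ (ℤ.+[1+ n ] ℤ.+ j)       ≡⟨ cong 2^_ (ℤ.suc-+ n j) ⟩
  2^ (ℤ.suc (+ n ℤ.+ j))      ≡⟨ 2^-suc (+ n ℤ.+ j) ⟩
  2ℚ * 2^ (+ n ℤ.+ j)         ≡⟨ cong (2ℚ *_) (2^-homo-+ (+ n) j) ⟩
  2ℚ * (2^ (+ n) * 2^ j)      ≡⟨ *-assoc 2ℚ (2^ (+ n)) (2^ j) ⟨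
  2ℚ * 2^ (+ n) * 2^ j        ∎
  where open ≡-Reasoning
2^-homo-+ -[1+ zero ] j = 2^-pred j
2^-homo-+ -[1+ suc n ] j = begin
  2^ (-[1+ suc n ] ℤ.+ j)        ≡⟨ cong 2^_ (ℤ.pred-+ -[1+ n ] j) ⟩
  2^ (ℤ.pred (-[1+ n ] ℤ.+ j))   ≡⟨ 2^-pred (-[1+ n ] ℤ.+ j) ⟩
  ½ * 2^ (-[1+ n ] ℤ.+ j)        ≡⟨ cong (½ *_) (2^-homo-+ -[1+ n ] j) ⟩
  ½ * (2^ -[1+ n ] * 2^ j)       ≡⟨ *-assoc ½ (2^ -[1+ n ]) (2^ j) ⟨
  ½ * 2^ -[1+ n ] * 2^ j         ∎
  where open ≡-Reasoning

2^-pos : ∀ i → 0ℚ < 2^ i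
2^-pos (+ n)    = ^-pos n (positive⁻¹ 2ℚ)
2^-pos -[1+ n ] = ^-pos (suc n) (positive⁻¹ ½)

2^-nonNeg : ∀ i → 0ℚ ≤ 2^ i
2^-nonNeg i = <⇒≤ (2^-pos i)

1≤2^n : ∀ n → 1ℚ ≤ 2^ (+ n)
1≤2^n n = subst (_≤ 2^ (+ n)) (1^n≡1 n) (^-mono-≤ {1ℚ} {2ℚ} n (nonNegative⁻¹ 1ℚ) (*≤* (ℤ.+≤+ (ℕ.s≤s ℕ.z≤n))))

2^-mono-≤ : ∀ {i j} → i ℤ.≤ j → 2^ i ≤ 2^ j
2^-mono-≤ {i} {j} i≤j = subst₂ _≤_ (*-identityʳ _) eq
  (*-monoˡ-≤ (2^-nonNeg i) (subst (λ k → 1ℚ ≤ 2^ k) ∣j-i∣≡j-i (1≤2^n ℤ.∣ j ℤ.- i ∣)))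
  where
  ∣j-i∣≡j-i : + ℤ.∣ j ℤ.- i ∣ ≡ j ℤ.- i
  ∣j-i∣≡j-i = ℤ.0≤i⇒+∣i∣≡i (ℤ.i≤j⇒0≤j-i i≤j)
  i+[j-i]≡j : i ℤ.+ (j ℤ.- i) ≡ j
  i+[j-i]≡j = begin
    i ℤ.+ (j ℤ.- i)         ≡⟨ ℤ.+-comm i (j ℤ.- i) ⟩
    j ℤ.- i ℤ.+ i           ≡⟨ ℤ.+-assoc j (ℤ.- i) i ⟩
    j ℤ.+ (ℤ.- i ℤ.+ i)     ≡⟨ cong (λ k → j ℤ.+ k) (ℤ.+-inverseˡ i) ⟩
    j ℤ.+ ℤ.0ℤ              ≡⟨ ℤ.+-identityʳ j ⟩
    j                       ∎
    where open ≡-Reasoning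
  eq : 2^ i * 2^ (j ℤ.- i) ≡ 2^ j
  eq = trans (sym (2^-homo-+ i (j ℤ.- i))) (cong 2^_ i+[j-i]≡j)

2^-mono-< : ∀ {i j} → i ℤ.< j → 2^ i < 2^ j
2^-mono-< {i} {j} i<j = <-≤-trans
  (subst₂ _<_ (*-identityˡ _) (sym (2^-suc i)) (*-monoʳ-< {1ℚ} {2ℚ} (2^-pos i) (*<* (ℤ.+<+ (ℕ.s≤s (ℕ.s≤s ℕ.z≤n))))))
  (2^-mono-≤ (ℤ.i<j⇒suc[i]≤j i<j))

2^-cancel-< : ∀ {i j} → 2^ i < 2^ j → i ℤ.< j
2^-cancel-< {i} {j} p = ℤ.≰⇒> λ j≤i → <-irrefl refl (<-≤-trans p (2^-mono-≤ j≤i))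

2^-homo-^ : ∀ i n → 2^ i ^ n ≡ 2^ (i ℤ.* + n)
2^-homo-^ i zero    = cong 2^_ (sym (ℤ.*-zeroʳ i))
2^-homo-^ i (suc n) = begin
  2^ i * 2^ i ^ n              ≡⟨ cong (2^ i *_) (2^-homo-^ i n) ⟩
  2^ i * 2^ (i ℤ.* + n)        ≡⟨ 2^-homo-+ i _ ⟨
  2^ (i ℤ.+ i ℤ.* + n)         ≡⟨ cong 2^_ (ℤ.*-suc i (+ n)) ⟨
  2^ (i ℤ.* + suc n)           ∎
  where open ≡-Reasoning

2^-neg : ∀ n → 2^ (ℤ.- (+ n)) ≡ ½ ^ n
2^-neg zero    = refl
2^-neg (suc n) = refl

⟦2^n⟧ : ∀ n → ⟦ + (2 ℕ.^ n) ⟧ ≡ 2^ (+ n)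
⟦2^n⟧ zero    = refl
⟦2^n⟧ (suc n) = begin
  ⟦ + (2 ℕ.* 2 ℕ.^ n) ⟧         ≡⟨ cong ⟦_⟧ (ℤ.pos-* 2 (2 ℕ.^ n)) ⟩
  ⟦ + 2 ℤ.* + (2 ℕ.^ n) ⟧       ≡⟨ ⟦⟧-homo-* (+ 2) (+ (2 ℕ.^ n)) ⟨
  2ℚ * ⟦ + (2 ℕ.^ n) ⟧          ≡⟨ cong (2ℚ *_) (⟦2^n⟧ n) ⟩
  2ℚ * 2^ (+ n)                 ∎
  where open ≡-Reasoning

-- Cuts

-- Logarithms are only compared with integers: for q = u / d, the inequality q < i means u < i d,
-- which is a comparison of 2^u with (2^i)^d.
log-lower⁺ : ∀ i {p q} → 2^ i ≤ p → q < ⟦ i ⟧ → lower (log p) q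
log-lower⁺ i {p} {q} 2^i≤p q<i = <-≤-trans
  (subst (2^ (↥ q) <_) (sym (2^-homo-^ i (↧ₙ q)))
    (2^-mono-< (subst (ℤ._< i ℤ.* ↧ q) (ℤ.*-identityʳ (↥ q)) (drop-*<* q<i))))
  (^-mono-≤ (↧ₙ q) (2^-nonNeg i) 2^i≤p)

log-lower⁻ : ∀ i {p q} → 0ℚ ≤ p → p ≤ 2^ i → lower (log p) q → q < ⟦ i ⟧
log-lower⁻ i {p} {q} 0≤p p≤2^i q<p = *<* (subst (ℤ._< i ℤ.* ↧ q) (sym (ℤ.*-identityʳ (↥ q)))
  (2^-cancel-< (subst (2^ (↥ q) <_) (2^-homo-^ i (↧ₙ q))
    (<-≤-trans q<p (^-mono-≤ (↧ₙ q) 0≤p p≤2^i)))))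

log-upper⁺ : ∀ i {p q} → 0ℚ ≤ p → p ≤ 2^ i → ⟦ i ⟧ < q → upper (log p) q
log-upper⁺ i {p} {q} 0≤p p≤2^i i<q = ≤-<-trans
  (^-mono-≤ (↧ₙ q) 0≤p p≤2^i)
  (subst (_< 2^ (↥ q)) (sym (2^-homo-^ i (↧ₙ q)))
    (2^-mono-< (subst (i ℤ.* ↧ q ℤ.<_) (ℤ.*-identityʳ (↥ q)) (drop-*<* i<q))))

-- Raising each defining inequality to the denominator of the other puts the same power of `p`
-- between two powers of two. Denominators are successors, as strict monotonicity of powers
-- requires.
log-disjoint : ∀ {p q r} → 0ℚ < p → lower (log p) q → upper (log p) r → q < r
log-disjoint {p} {q} {r} 0<p q<p p<r = *<* (2^-cancel-< (begin-strict
  2^ (↥ q ℤ.* ↧ r)             ≡⟨ 2^-homo-^ (↥ q) (↧ₙ r) ⟨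
  2^ (↥ q) ^ (↧ₙ r)            <⟨ ^-mono-< (ℚ.denominator-1 r) (2^-nonNeg (↥ q)) q<p ⟩
  (p ^ (↧ₙ q)) ^ (↧ₙ r)        ≡⟨ ^-assocʳ p (↧ₙ q) (↧ₙ r) ⟩
  p ^ (↧ₙ q ℕ.* ↧ₙ r)          ≡⟨ cong (p ^_) (ℕ.*-comm (↧ₙ q) (↧ₙ r)) ⟩
  p ^ (↧ₙ r ℕ.* ↧ₙ q)          ≡⟨ ^-assocʳ p (↧ₙ r) (↧ₙ q) ⟨
  (p ^ (↧ₙ r)) ^ (↧ₙ q)        <⟨ ^-mono-< (ℚ.denominator-1 q) (^-nonNeg (↧ₙ r) (<⇒≤ 0<p)) p<r ⟩
  2^ (↥ r) ^ (↧ₙ q)            ≡⟨ 2^-homo-^ (↥ r) (↧ₙ q) ⟩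
  2^ (↥ r ℤ.* ↧ q)             ∎))
  where open ≤-Reasoning

-- Reciprocals of natural numbers

-- The value 0 at zero makes `mean` total and spares `recip-*` any side condition.
recip : ℕ → ℚ
recip zero    = 0ℚ
recip (suc n) = 1/ ⟦ + suc n ⟧

recip-inverse : ∀ n .{{_ : ℕ.NonZero n}} → ⟦ + n ⟧ * recip n ≡ 1ℚ
recip-inverse (suc n) = *-inverseʳ ⟦ + suc n ⟧

inverse-unique : ∀ {x y z} → x * y ≡ 1ℚ → x * z ≡ 1ℚ → y ≡ z
inverse-unique {x} {y} {z} xy≡1 xz≡1 = begin
  y              ≡⟨ *-identityʳ y ⟨
  y * 1ℚ         ≡⟨ cong (y *_) xz≡1 ⟨
  y * (x * z)    ≡⟨ solve 3 (λ x y z → y :* (x :* z) := (x :* y) :* z) refl x y z ⟩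
  (x * y) * z    ≡⟨ cong (_* z) xy≡1 ⟩
  1ℚ * z         ≡⟨ *-identityˡ z ⟩
  z              ∎
  where
  open ≡-Reasoning

recip-* : ∀ m n → recip (m ℕ.* n) ≡ recip m * recip n
recip-* zero n = sym (*-zeroˡ (recip n))
recip-* (suc m) zero = trans (cong recip (ℕ.*-zeroʳ (suc m))) (sym (*-zeroʳ (recip (suc m))))
recip-* m@(suc _) n@(suc _) = inverse-unique (recip-inverse (m ℕ.* n)) (begin
  ⟦ + (m ℕ.* n) ⟧ * (recip m * recip n)
    ≡⟨ cong (_* (recip m * recip n)) (trans (cong ⟦_⟧ (ℤ.pos-* m n)) (sym (⟦⟧-homo-* (+ m) (+ n)))) ⟩
  (⟦ + m ⟧ * ⟦ + n ⟧) * (recip m * recip n)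
    ≡⟨ solve 4 (λ a b c d → (a :* b) :* (c :* d) := (a :* c) :* (b :* d)) refl ⟦ + m ⟧ ⟦ + n ⟧ (recip m) (recip n) ⟩
  (⟦ + m ⟧ * recip m) * (⟦ + n ⟧ * recip n)
    ≡⟨ cong₂ _*_ (recip-inverse m) (recip-inverse n) ⟩
  1ℚ * 1ℚ
    ∎)
  where
  open ≡-Reasoning

recip-nonNeg : ∀ n → 0ℚ ≤ recip n
recip-nonNeg zero    = ≤-refl
recip-nonNeg (suc n) = <⇒≤ (positive⁻¹ (recip (suc n)))

k/n≡k*recip : ∀ k n .{{_ : ℕ.NonZero n}} → + k / n ≡ ⟦ + k ⟧ * recip n
k/n≡k*recip k n@(suc _) = /-cong {q₁ = n} {q₂ = 1 ℕ.* n} (sym (ℤ.*-identityʳ (+ k))) (sym (ℕ.*-identityˡ n))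

ind : Bool → ℚ
ind true  = 1ℚ
ind false = 0ℚ

ind-∧ : ∀ a b → ind (a ∧ b) ≡ ind a * ind b
ind-∧ true  b = sym (*-identityˡ (ind b))
ind-∧ false b = sym (*-zeroˡ (ind b))

ind-nonNeg : ∀ a → 0ℚ ≤ ind a
ind-nonNeg true  = nonNegative⁻¹ 1ℚ
ind-nonNeg false = ≤-refl

ind≤1 : ∀ a → ind a ≤ 1ℚ
ind≤1 true  = ≤-refl
ind≤1 false = nonNegative⁻¹ 1ℚ

-- Sums and means over lists

Σᴸ : List A → (A → ℚ) → ℚ
Σᴸ []       f = 0ℚ
Σᴸ (x ∷ xs) f = f x + Σᴸ xs f

Σᴸ-cong : ∀ (xs : List A) {f g} → (∀ x → f x ≡ g x) → Σᴸ xs f ≡ Σᴸ xs g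
Σᴸ-cong []       f≗g = refl
Σᴸ-cong (x ∷ xs) f≗g = cong₂ _+_ (f≗g x) (Σᴸ-cong xs f≗g)

Σᴸ-+ : ∀ (xs : List A) f g → Σᴸ xs (λ x → f x + g x) ≡ Σᴸ xs f + Σᴸ xs g
Σᴸ-+ []       f g = refl
Σᴸ-+ (x ∷ xs) f g = trans (cong (λ p → f x + g x + p) (Σᴸ-+ xs f g))
  (solve 4 (λ a b c d → (a :+ b) :+ (c :+ d) := (a :+ c) :+ (b :+ d)) refl (f x) (g x) (Σᴸ xs f) (Σᴸ xs g))

Σᴸ-*ˡ : ∀ (xs : List A) c f → Σᴸ xs (λ x → c * f x) ≡ c * Σᴸ xs f
Σᴸ-*ˡ []       c f = sym (*-zeroʳ c)
Σᴸ-*ˡ (x ∷ xs) c f = trans (cong (λ p → c * f x + p) (Σᴸ-*ˡ xs c f)) (sym (*-distribˡ-+ c (f x) (Σᴸ xs f)))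

Σᴸ-mono : ∀ (xs : List A) {f g} → (∀ x → f x ≤ g x) → Σᴸ xs f ≤ Σᴸ xs g
Σᴸ-mono []       f≤g = ≤-refl
Σᴸ-mono (x ∷ xs) f≤g = +-mono-≤ (f≤g x) (Σᴸ-mono xs f≤g)

Σᴸ-const : ∀ (xs : List A) c → Σᴸ xs (λ _ → c) ≡ ⟦ + length xs ⟧ * c
Σᴸ-const []       c = sym (*-zeroˡ c)
Σᴸ-const (x ∷ xs) c = begin
  c + Σᴸ xs (λ _ → c)             ≡⟨ cong₂ _+_ (sym (*-identityˡ c)) (Σᴸ-const xs c) ⟩
  1ℚ * c + ⟦ + length xs ⟧ * c    ≡⟨ *-distribʳ-+ c 1ℚ ⟦ + length xs ⟧ ⟨
  (1ℚ + ⟦ + length xs ⟧) * c      ≡⟨ cong (_* c) (⟦⟧-homo-+ (+ 1) (+ length xs)) ⟩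
  ⟦ + suc (length xs) ⟧ * c       ∎
  where open ≡-Reasoning

Σᴸ-++ : ∀ (xs ys : List A) f → Σᴸ (xs ++ ys) f ≡ Σᴸ xs f + Σᴸ ys f
Σᴸ-++ []       ys f = sym (+-identityˡ _)
Σᴸ-++ (x ∷ xs) ys f = trans (cong (λ p → f x + p) (Σᴸ-++ xs ys f)) (sym (+-assoc (f x) (Σᴸ xs f) (Σᴸ ys f)))

Σᴸ-map : ∀ (h : A → B) xs f → Σᴸ (List.map h xs) f ≡ Σᴸ xs (f ∘ h)
Σᴸ-map h []       f = refl
Σᴸ-map h (x ∷ xs) f = cong (λ p → f (h x) + p) (Σᴸ-map h xs f)

Σᴸ-cartesian : ∀ (h : A → B → C) xs ys f →
  Σᴸ (cartesianProductWith h xs ys) f ≡ Σᴸ xs (λ x → Σᴸ ys (f ∘ h x))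
Σᴸ-cartesian h []       ys f = refl
Σᴸ-cartesian h (x ∷ xs) ys f = trans (Σᴸ-++ (List.map (h x) ys) _ f)
  (cong₂ _+_ (Σᴸ-map (h x) ys f) (Σᴸ-cartesian h xs ys f))

length-cartesian : ∀ (h : A → B → C) xs ys →
  length (cartesianProductWith h xs ys) ≡ length xs ℕ.* length ys
length-cartesian h []       ys = refl
length-cartesian h (x ∷ xs) ys = trans (length-++ (List.map (h x) ys))
  (cong₂ ℕ._+_ (length-map (h x) ys) (length-cartesian h xs ys))

length-filterᵇ : ∀ (e : A → Bool) xs → ⟦ + length (filterᵇ e xs) ⟧ ≡ Σᴸ xs (ind ∘ e)
length-filterᵇ e [] = refl
length-filterᵇ e (x ∷ xs) with e x
... | true  = trans (sym (⟦⟧-homo-+ (+ 1) (+ length (filterᵇ e xs)))) (cong (λ p → 1ℚ + p) (length-filterᵇ e xs))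
... | false = trans (length-filterᵇ e xs) (sym (+-identityˡ _))

opaque
  -- Expectation over a uniform entry. Every probability below is rewritten as an iterated mean, one
  -- for each independent bit or block; over the empty list the value is 0.
  mean : List A → (A → ℚ) → ℚ
  mean xs f = Σᴸ xs f * recip (length xs)

  mean-cong : ∀ (xs : List A) {f g} → (∀ x → f x ≡ g x) → mean xs f ≡ mean xs g
  mean-cong xs f≗g = cong (_* recip (length xs)) (Σᴸ-cong xs f≗g)

  mean-+ : ∀ (xs : List A) f g → mean xs (λ x → f x + g x) ≡ mean xs f + mean xs g
  mean-+ xs f g = trans (cong (_* recip (length xs)) (Σᴸ-+ xs f g))
    (*-distribʳ-+ (recip (length xs)) (Σᴸ xs f) (Σᴸ xs g))

  mean-*ˡ : ∀ (xs : List A) c f → mean xs (λ x → c * f x) ≡ c * mean xs f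
  mean-*ˡ xs c f = trans (cong (_* recip (length xs)) (Σᴸ-*ˡ xs c f)) (*-assoc c (Σᴸ xs f) (recip (length xs)))

mean-*ʳ : ∀ (xs : List A) c f → mean xs (λ x → f x * c) ≡ mean xs f * c
mean-*ʳ xs c f = trans (mean-cong xs (λ x → *-comm (f x) c)) (trans (mean-*ˡ xs c f) (*-comm c (mean xs f)))

mean-neg : ∀ (xs : List A) f → mean xs (λ x → - f x) ≡ - mean xs f
mean-neg xs f = begin
  mean xs (λ x → - f x)          ≡⟨ mean-cong xs (λ x → -≡-1* (f x)) ⟩
  mean xs (λ x → - 1ℚ * f x)     ≡⟨ mean-*ˡ xs (- 1ℚ) f ⟩
  - 1ℚ * mean xs f               ≡⟨ -≡-1* (mean xs f) ⟨
  - mean xs f                    ∎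
  where
  open ≡-Reasoning
  -≡-1* : ∀ p → - p ≡ - 1ℚ * p
  -≡-1* p = trans (cong -_ (sym (*-identityˡ p))) (neg-distribˡ-* 1ℚ p)

mean-minus : ∀ (xs : List A) f g → mean xs (λ x → f x - g x) ≡ mean xs f - mean xs g
mean-minus xs f g = trans (mean-+ xs f (λ x → - g x)) (cong (λ p → mean xs f + p) (mean-neg xs g))

opaque
  unfolding mean

  mean-mono : ∀ (xs : List A) {f g} → (∀ x → f x ≤ g x) → mean xs f ≤ mean xs g
  mean-mono xs f≤g = *-monoʳ-≤ (recip-nonNeg (length xs)) (Σᴸ-mono xs f≤g)

  mean-const : ∀ (xs : List A) .{{_ : ℕ.NonZero (length xs)}} c → mean xs (λ _ → c) ≡ c
  mean-const xs c = begin
    Σᴸ xs (λ _ → c) * r        ≡⟨ cong (_* r) (Σᴸ-const xs c) ⟩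
    ⟦ + length xs ⟧ * c * r    ≡⟨ solve 3 (λ l c r → l :* c :* r := l :* r :* c) refl ⟦ + length xs ⟧ c r ⟩
    ⟦ + length xs ⟧ * r * c    ≡⟨ cong (_* c) (recip-inverse (length xs)) ⟩
    1ℚ * c                     ≡⟨ *-identityˡ c ⟩
    c                          ∎
    where
    r : ℚ
    r = recip (length xs)
    open ≡-Reasoning

  mean-nonNeg : ∀ (xs : List A) {f} → (∀ x → 0ℚ ≤ f x) → 0ℚ ≤ mean xs f
  mean-nonNeg xs {f} 0≤f = subst (_≤ mean xs f)
    (trans (cong (_* recip (length xs)) (trans (Σᴸ-const xs 0ℚ) (*-zeroʳ ⟦ + length xs ⟧)))
      (*-zeroˡ (recip (length xs))))
    (mean-mono xs 0≤f)

  mean-cartesian : ∀ (h : A → B → C) xs ys f →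
    mean (cartesianProductWith h xs ys) f ≡ mean xs (λ x → mean ys (f ∘ h x))
  mean-cartesian {A = X} h xs ys f = begin
    Σᴸ (cartesianProductWith h xs ys) f * recip (length (cartesianProductWith h xs ys))
      ≡⟨ cong₂ _*_ (Σᴸ-cartesian h xs ys f)
           (trans (cong recip (length-cartesian h xs ys)) (recip-* (length xs) (length ys))) ⟩
    Σᴸ xs F * (recip (length xs) * recip (length ys))
      ≡⟨ solve 3 (λ a b c → a :* (b :* c) := a :* b :* c) refl (Σᴸ xs F) (recip (length xs)) (recip (length ys)) ⟩
    mean xs F * recip (length ys)
      ≡⟨ mean-*ʳ xs (recip (length ys)) F ⟨
    mean xs (λ x → mean ys (f ∘ h x))
      ∎
    where
    F : X → ℚ
    F = λ x → Σᴸ ys (f ∘ h x)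
    open ≡-Reasoning

-- Uniform vectors and words

length-allVecs : ∀ (xs : List A) m → length (allVecs xs m) ≡ length xs ℕ.^ m
length-allVecs xs zero    = refl
length-allVecs xs (suc m) = trans (length-cartesian _∷_ xs (allVecs xs m))
  (cong (length xs ℕ.*_) (length-allVecs xs m))

length-allΛ : ∀ b → length (allΛ b) ≡ 2 ℕ.^ b
length-allΛ = length-allVecs (false ∷ true ∷ [])

allVecs-nonZero : ∀ (xs : List A) m .{{_ : ℕ.NonZero (length xs)}} → ℕ.NonZero (length (allVecs xs m))
allVecs-nonZero xs m = subst ℕ.NonZero (sym (length-allVecs xs m)) (ℕ.m^n≢0 (length xs) m)

allΛ-nonZero : ∀ b → ℕ.NonZero (length (allΛ b))
allΛ-nonZero b = allVecs-nonZero (false ∷ true ∷ []) b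

mean-allVecs : ∀ (xs : List A) m f →
  mean (allVecs xs (suc m)) f ≡ mean xs (λ x → mean (allVecs xs m) (λ v → f (x ∷ v)))
mean-allVecs xs m f = mean-cartesian _∷_ xs (allVecs xs m) f

opaque
  unfolding mean

  mean-bit : ∀ f → mean (false ∷ true ∷ []) f ≡ ½ * (f false + f true)
  mean-bit f = trans (cong (λ p → (f false + p) * ½) (+-identityʳ (f true))) (*-comm (f false + f true) ½)

mean-allΛ : ∀ b f → mean (allΛ (suc b)) f ≡
  ½ * (mean (allΛ b) (f ∘ (false ∷_)) + mean (allΛ b) (f ∘ (true ∷_)))
mean-allΛ b f = trans (mean-allVecs (false ∷ true ∷ []) b f) (mean-bit (λ x → mean (allΛ b) (λ v → f (x ∷ v))))

mean-≟ : ∀ b (u : Λ b) → mean (allΛ b) (λ w → ind (does (w ≟ᵇ u))) ≡ ½ ^ b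
mean-≟ zero    []      = trans (mean-cong (allΛ 0) λ { [] → refl }) (mean-const (allΛ 0) 1ℚ)
mean-≟ (suc b) (u₀ ∷ u) = trans (mean-allΛ b (λ w → ind (does (w ≟ᵇ (u₀ ∷ u))))) (cong (½ *_) (halves u₀))
  where
  halves : ∀ u₀ → mean (allΛ b) (λ w → ind (does ((false ∷ w) ≟ᵇ (u₀ ∷ u))))
                + mean (allΛ b) (λ w → ind (does ((true ∷ w) ≟ᵇ (u₀ ∷ u)))) ≡ ½ ^ b
  halves true  = trans (cong₂ _+_ (mean-const (allΛ b) {{allΛ-nonZero b}} 0ℚ) (mean-≟ b u)) (+-identityˡ (½ ^ b))
  halves false = trans (cong₂ _+_ (mean-≟ b u) (mean-const (allΛ b) {{allΛ-nonZero b}} 0ℚ)) (+-identityʳ (½ ^ b))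

-- Uniform probability spaces

sum-lookup : ∀ (xs : List A) f → sum (λ i → f (List.lookup xs i)) ≡ Σᴸ xs f
sum-lookup []       f = refl
sum-lookup (x ∷ xs) f = cong (λ p → f x + p) (sum-lookup xs f)

uniform : (xs : List A) .{{_ : ℕ.NonZero (length xs)}} → ProbSpace
uniform xs = record
  { size     = length xs
  ; weight   = λ _ → recip (length xs)
  ; weight≥0 = λ _ → recip-nonNeg (length xs)
  ; total    = trans (sum-lookup xs (λ _ → recip (length xs)))
                 (trans (Σᴸ-const xs (recip (length xs))) (recip-inverse (length xs)))
  }

opaque
  unfolding mean

  Pr-uniform : ∀ (xs : List A) .{{_ : ℕ.NonZero (length xs)}} (e : A → Bool) →
    Pr (uniform xs) (λ ω → e (List.lookup xs ω)) ≡ mean xs (ind ∘ e)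
  Pr-uniform xs e = begin
    sum (λ i → if e (List.lookup xs i) then r else 0ℚ)   ≡⟨ sum-lookup xs (λ x → if e x then r else 0ℚ) ⟩
    Σᴸ xs (λ x → if e x then r else 0ℚ)                  ≡⟨ Σᴸ-cong xs (λ x → if≡* (e x)) ⟩
    Σᴸ xs (λ x → r * ind (e x))                          ≡⟨ Σᴸ-*ˡ xs r (ind ∘ e) ⟩
    r * Σᴸ xs (ind ∘ e)                                  ≡⟨ *-comm r (Σᴸ xs (ind ∘ e)) ⟩
    mean xs (ind ∘ e)                                    ∎
    where
    r : ℚ
    r = recip (length xs)
    if≡* : ∀ a → (if a then r else 0ℚ) ≡ r * ind a
    if≡* true  = sym (*-identityʳ r)
    if≡* false = sym (*-zeroʳ r)
    open ≡-Reasoning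

-- The definition of conditional probability with the denominator cleared; `likely` cancels it at
-- the end.
Pr-condition : ∀ P E F (pos : 0ℚ < Pr P E) →
  Pr (condition P E pos) F * Pr P E ≡ Pr P (λ ω → E ω ∧ F ω)
Pr-condition P E F pos = begin
  Pr (condition P E pos) F * p
    ≡⟨ cong (_* p) (sum-cong-≗ {size P} restrict-condition) ⟩
  sum (λ ω → restrict P (λ ω → E ω ∧ F ω) ω * p⁻¹) * p
    ≡⟨ cong (_* p) (*-distribʳ-sum p⁻¹ (restrict P (λ ω → E ω ∧ F ω))) ⟨
  Pr P (λ ω → E ω ∧ F ω) * p⁻¹ * p
    ≡⟨ *-assoc (Pr P (λ ω → E ω ∧ F ω)) p⁻¹ p ⟩
  Pr P (λ ω → E ω ∧ F ω) * (p⁻¹ * p)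
    ≡⟨ cong (Pr P (λ ω → E ω ∧ F ω) *_) (*-inverseˡ p) ⟩
  Pr P (λ ω → E ω ∧ F ω) * 1ℚ
    ≡⟨ *-identityʳ _ ⟩
  Pr P (λ ω → E ω ∧ F ω)
    ∎
  where
  open ≡-Reasoning
  p = Pr P E
  instance
    p≢0 : NonZero p
    p≢0 = pos⇒nonZero p {{positive pos}}
  p⁻¹ = 1/ p
  restrict-condition : ∀ ω → restrict (condition P E pos) F ω ≡ restrict P (λ ω → E ω ∧ F ω) ω * p⁻¹
  restrict-condition ω = nested-if (weight P ω) (E ω) (F ω)
    where
    nested-if : ∀ w a b → (if b then (if a then w else 0ℚ) * p⁻¹ else 0ℚ) ≡ (if a ∧ b then w else 0ℚ) * p⁻¹
    nested-if w true  true  = refl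
    nested-if w true  false = sym (*-zeroˡ p⁻¹)
    nested-if w false true  = refl
    nested-if w false false = sym (*-zeroˡ p⁻¹)

-- Halving bit by bit: of the two values of the first bit, the one with the smaller weighted mean
-- gets at most half. The weight `h` records which bits have been fixed, so that the induction can
-- pass to the tail.
unlikely-value : ∀ (xs : List A) {m} (W : A → Vec Bool m) (h : A → ℚ) →
  ∃[ z ] mean xs (λ x → h x * ind (does (W x ≟ᵇ z))) ≤ ½ ^ m * mean xs h
unlikely-value xs {zero} W h = [] , ≤-reflexive (trans
  (mean-cong xs λ x → trans (cong (λ w → h x * ind (does (w ≟ᵇ []))) (empty (W x))) (*-identityʳ (h x)))
  (sym (*-identityˡ (mean xs h))))
  where
  empty : (w : Vec Bool 0) → w ≡ []
  empty [] = refl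
unlikely-value {A} xs {suc m} W h = choose (≤-total (mean xs (part true)) (mean xs (part false)))
  where
  part : Bool → A → ℚ
  part a x = h x * ind (does (Vec.head (W x) Bool.≟ a))
  split : mean xs (part true) + mean xs (part false) ≡ mean xs h
  split = trans (sym (mean-+ xs (part true) (part false))) (mean-cong xs λ x → lemma (h x) (Vec.head (W x)))
    where
    lemma : ∀ p a → p * ind (does (a Bool.≟ true)) + p * ind (does (a Bool.≟ false)) ≡ p
    lemma p true  = trans (cong₂ _+_ (*-identityʳ p) (*-zeroʳ p)) (+-identityʳ p)
    lemma p false = trans (cong₂ _+_ (*-zeroʳ p) (*-identityʳ p)) (+-identityˡ p)
  half : ∀ {p q} → p ≤ q → p ≤ ½ * (p + q)
  half {p} {q} p≤q = subst (_≤ ½ * (p + q)) (solve 1 (λ p → con ½ :* (p :+ p) := p) refl p)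
    (*-monoˡ-≤ (nonNegative⁻¹ ½) (+-monoʳ-≤ p p≤q))
  refine : ∀ a → mean xs (part a) ≤ ½ * mean xs h →
    ∃[ z ] mean xs (λ x → h x * ind (does (W x ≟ᵇ z))) ≤ ½ ^ suc m * mean xs h
  refine a rare with unlikely-value xs (Vec.tail ∘ W) (part a)
  ... | z , z-rare = a ∷ z , (begin
    mean xs (λ x → h x * ind (does (W x ≟ᵇ (a ∷ z))))
      ≡⟨ mean-cong xs (λ x → factor (h x) (W x)) ⟩
    mean xs (λ x → part a x * ind (does (Vec.tail (W x) ≟ᵇ z)))
      ≤⟨ z-rare ⟩
    ½ ^ m * mean xs (part a)
      ≤⟨ *-monoˡ-≤ (^-nonNeg m (nonNegative⁻¹ ½)) rare ⟩
    ½ ^ m * (½ * mean xs h)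
      ≡⟨ solve 3 (λ a b c → a :* (b :* c) := b :* a :* c) refl (½ ^ m) ½ (mean xs h) ⟩
    ½ ^ suc m * mean xs h
      ∎)
    where
    open ≤-Reasoning
    factor : ∀ p w → p * ind (does (w ≟ᵇ (a ∷ z))) ≡
      p * ind (does (Vec.head w Bool.≟ a)) * ind (does (Vec.tail w ≟ᵇ z))
    factor p (w₀ ∷ w) = trans (cong (p *_) (ind-∧ (does (w₀ Bool.≟ a)) (does (w ≟ᵇ z))))
      (sym (*-assoc p (ind (does (w₀ Bool.≟ a))) (ind (does (w ≟ᵇ z)))))
  choose : _ → _
  choose (inj₁ t≤f) = refine true (subst (λ p → mean xs (part true) ≤ ½ * p) split (half t≤f))
  choose (inj₂ f≤t) = refine false (subst (λ p → mean xs (part false) ≤ ½ * p)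
    (trans (+-comm (mean xs (part false)) (mean xs (part true))) split) (half f≤t))

p≤∣p∣ : ∀ p → p ≤ ∣ p ∣
p≤∣p∣ p with ≤-total 0ℚ p
... | inj₁ 0≤p = ≤-reflexive (sym (0≤p⇒∣p∣≡p 0≤p))
... | inj₂ p≤0 = ≤-trans p≤0 (0≤∣p∣ p)

∣p∣≤q : ∀ {p q} → p ≤ q → - p ≤ q → ∣ p ∣ ≤ q
∣p∣≤q {p} p≤q -p≤q with ∣p∣≡p∨∣p∣≡-p p
... | inj₁ eq = ≤-trans (≤-reflexive eq) p≤q
... | inj₂ eq = ≤-trans (≤-reflexive eq) -p≤q

-- The gadget

prefix : ℕ → Vec Bool m → List Bool
prefix zero    xs       = []
prefix (suc t) []       = []
prefix (suc t) (x ∷ xs) = x ∷ prefix t xs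

-- The first argument is a list so that a chunk decoded from the first block of Y can take the place
-- of a prefix of x. Missing entries count as 0.
ip : List Bool → Vec Bool m → Bool
ip []      ys       = false
ip (x ∷ p) []       = false
ip (x ∷ p) (y ∷ ys) = (x ∧ y) xor ip p ys

gadget : ℕ → Gadget b
gadget t []      []       = false
gadget t (_ ∷ x) (y₀ ∷ y) = y₀ xor ip (prefix t x) y

sgn : Bool → ℚ
sgn false = 1ℚ
sgn true  = - 1ℚ

sgn-xor : ∀ x y → sgn (x xor y) ≡ sgn x * sgn y
sgn-xor false y     = sym (*-identityˡ (sgn y))
sgn-xor true  false = refl
sgn-xor true  true  = refl

-- The variance is nonnegative.
mean-square : ∀ (xs : List A) .{{_ : ℕ.NonZero (length xs)}} f → mean xs f * mean xs f ≤ mean xs (λ x → f x * f x)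
mean-square xs f = subst₂ _≤_ (+-identityʳ (M * M)) complete-square
  (+-monoʳ-≤ (M * M) (mean-nonNeg xs (λ x → square-nonNeg (f x - M))))
  where
  M = mean xs f
  open ≡-Reasoning
  expand : mean xs (λ x → (f x - M) * (f x - M)) ≡ mean xs (λ x → f x * f x) + (- (M + M) * M + M * M)
  expand = begin
    mean xs (λ x → (f x - M) * (f x - M))
      ≡⟨ mean-cong xs (λ x → solve 2 (λ a m → (a :- m) :* (a :- m) := a :* a :+ (:- (m :+ m) :* a :+ m :* m))
            refl (f x) M) ⟩
    mean xs (λ x → f x * f x + (- (M + M) * f x + M * M))
      ≡⟨ mean-+ xs (λ x → f x * f x) (λ x → - (M + M) * f x + M * M) ⟩
    mean xs (λ x → f x * f x) + mean xs (λ x → - (M + M) * f x + M * M)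
      ≡⟨ cong (λ p → mean xs (λ x → f x * f x) + p) (mean-+ xs (λ x → - (M + M) * f x) (λ _ → M * M)) ⟩
    mean xs (λ x → f x * f x) + (mean xs (λ x → - (M + M) * f x) + mean xs (λ _ → M * M))
      ≡⟨ cong (λ p → mean xs (λ x → f x * f x) + p) (cong₂ _+_ (mean-*ˡ xs (- (M + M)) f) (mean-const xs (M * M))) ⟩
    mean xs (λ x → f x * f x) + (- (M + M) * M + M * M)
      ∎
  complete-square : M * M + mean xs (λ x → (f x - M) * (f x - M)) ≡ mean xs (λ x → f x * f x)
  complete-square = trans (cong (λ p → M * M + p) expand)
    (solve 2 (λ m s → m :* m :+ (s :+ (:- (m :+ m) :* m :+ m :* m)) := s) refl M (mean xs (λ x → f x * f x)))

-- The Walsh-Fourier coefficient of `f` at the character given by the first `t` bits of `x`, padded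
-- with zeros.
walsh : ℕ → (Λ b → ℚ) → Λ b → ℚ
walsh {b} t f x = mean (allΛ b) (λ y → f y * sgn (ip (prefix t x) y))

-- The butterfly step of the fast Walsh-Hadamard transform.
walsh-suc : ∀ t (f : Λ (suc b) → ℚ) x₀ x → walsh (suc t) f (x₀ ∷ x) ≡
  ½ * (walsh t (f ∘ (false ∷_)) x + sgn x₀ * walsh t (f ∘ (true ∷_)) x)
walsh-suc {b} t f x₀ x = trans (mean-allΛ b (λ y → f y * sgn (ip (x₀ ∷ prefix t x) y)))
  (cong₂ (λ p q → ½ * (p + q)) (mean-cong (allΛ b) (λ y → head-false x₀ y))
    (trans (mean-cong (allΛ b) (λ y → head-true x₀ y)) (mean-*ˡ (allΛ b) (sgn x₀) _)))
  where
  head-false : ∀ x₀ y → f (false ∷ y) * sgn ((x₀ ∧ false) xor ip (prefix t x) y) ≡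
    f (false ∷ y) * sgn (ip (prefix t x) y)
  head-false false y = refl
  head-false true  y = refl
  head-true : ∀ x₀ y → f (true ∷ y) * sgn ((x₀ ∧ true) xor ip (prefix t x) y) ≡
    sgn x₀ * (f (true ∷ y) * sgn (ip (prefix t x) y))
  head-true false y = sym (*-identityˡ _)
  head-true true  y = trans (cong (f (true ∷ y) *_) (sgn-xor true (ip (prefix t x) y)))
    (solve 3 (λ a b c → a :* (b :* c) := b :* (a :* c)) refl (f (true ∷ y)) (- 1ℚ) (sgn (ip (prefix t x) y)))

-- Parseval's identity, as an inequality since only the first t coordinates
-- are transformed.
parseval : ∀ t b → t ℕ.≤ b → (f : Λ b → ℚ) →
  mean (allΛ b) (λ x → walsh t f x * walsh t f x) ≤ ½ ^ t * mean (allΛ b) (λ y → f y * f y)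
parseval zero b _ f = subst₂ _≤_
  (sym (trans (mean-cong (allΛ b) (λ x → cong₂ _*_ walsh-zero walsh-zero))
    (mean-const (allΛ b) {{allΛ-nonZero b}} (M * M))))
  (sym (*-identityˡ _))
  (mean-square (allΛ b) {{allΛ-nonZero b}} f)
  where
  M = mean (allΛ b) f
  walsh-zero : mean (allΛ b) (λ y → f y * 1ℚ) ≡ M
  walsh-zero = mean-cong (allΛ b) (λ y → *-identityʳ (f y))
parseval (suc t) (suc b) (ℕ.s≤s t≤b) f = begin
  mean (allΛ (suc b)) (λ x → walsh (suc t) f x * walsh (suc t) f x)
    ≡⟨ mean-allΛ b (λ x → walsh (suc t) f x * walsh (suc t) f x) ⟩
  ½ * (mean (allΛ b) (λ x → walsh (suc t) f (false ∷ x) * walsh (suc t) f (false ∷ x))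
     + mean (allΛ b) (λ x → walsh (suc t) f (true ∷ x) * walsh (suc t) f (true ∷ x)))
    ≡⟨ cong (½ *_) (mean-+ (allΛ b) (λ x → walsh (suc t) f (false ∷ x) * walsh (suc t) f (false ∷ x)) _) ⟨
  ½ * mean (allΛ b) (λ x → walsh (suc t) f (false ∷ x) * walsh (suc t) f (false ∷ x)
                         + walsh (suc t) f (true ∷ x) * walsh (suc t) f (true ∷ x))
    ≡⟨ cong (½ *_) (mean-cong (allΛ b) parallelogram) ⟩
  ½ * mean (allΛ b) (λ x → ½ * (W₀ x * W₀ x + W₁ x * W₁ x))
    ≡⟨ cong (½ *_) (mean-*ˡ (allΛ b) ½ (λ x → W₀ x * W₀ x + W₁ x * W₁ x)) ⟩
  ½ * (½ * mean (allΛ b) (λ x → W₀ x * W₀ x + W₁ x * W₁ x))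
    ≡⟨ cong (λ p → ½ * (½ * p)) (mean-+ (allΛ b) (λ x → W₀ x * W₀ x) (λ x → W₁ x * W₁ x)) ⟩
  ½ * (½ * (mean (allΛ b) (λ x → W₀ x * W₀ x) + mean (allΛ b) (λ x → W₁ x * W₁ x)))
    ≤⟨ *-monoˡ-≤ 0≤½ (*-monoˡ-≤ 0≤½ (+-mono-≤ (parseval t b t≤b f₀) (parseval t b t≤b f₁))) ⟩
  ½ * (½ * (½ ^ t * S₀ + ½ ^ t * S₁))
    ≡⟨ solve 4 (λ h p a c → h :* (h :* (p :* a :+ p :* c)) := (h :* p) :* (h :* (a :+ c))) refl ½ (½ ^ t) S₀ S₁ ⟩
  ½ ^ suc t * (½ * (S₀ + S₁))
    ≡⟨ cong (½ ^ suc t *_) (mean-allΛ b (λ y → f y * f y)) ⟨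
  ½ ^ suc t * mean (allΛ (suc b)) (λ y → f y * f y)
    ∎
  where
  open ≤-Reasoning
  0≤½ : 0ℚ ≤ ½
  0≤½ = nonNegative⁻¹ ½
  f₀ = f ∘ (false ∷_)
  f₁ = f ∘ (true ∷_)
  W₀ = walsh t f₀
  W₁ = walsh t f₁
  S₀ = mean (allΛ b) (λ y → f₀ y * f₀ y)
  S₁ = mean (allΛ b) (λ y → f₁ y * f₁ y)
  parallelogram : ∀ x → walsh (suc t) f (false ∷ x) * walsh (suc t) f (false ∷ x)
                      + walsh (suc t) f (true ∷ x) * walsh (suc t) f (true ∷ x)
                      ≡ ½ * (W₀ x * W₀ x + W₁ x * W₁ x)
  parallelogram x = trans
    (cong₂ _+_ (cong₂ _*_ (walsh-suc t f false x) (walsh-suc t f false x))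
               (cong₂ _*_ (walsh-suc t f true x) (walsh-suc t f true x)))
    (solve 2 (λ p q → (con ½ :* (p :+ con 1ℚ :* q)) :* (con ½ :* (p :+ con 1ℚ :* q))
                   :+ (con ½ :* (p :+ con (- 1ℚ) :* q)) :* (con ½ :* (p :+ con (- 1ℚ) :* q))
                   := con ½ :* (p :* p :+ q :* q)) refl (W₀ x) (W₁ x))

-- Correlation of the gadget with a product of functions of the two arguments

transform : Gadget b → (Λ b → ℚ) → Λ b → ℚ
transform {b} g f u = mean (allΛ b) (λ v → f v * sgn (g u v))

correlation : Gadget b → (Λ b → ℚ) → (Λ b → ℚ) → ℚ
correlation {b} g a f = mean (allΛ b) (λ u → a u * transform g f u)

-- The mean is split by the first bit of v; setting that bit flips the sign of the gadget, hence the
-- difference.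
transform-gadget : ∀ t (f : Λ (suc b) → ℚ) x₀ x → transform (gadget t) f (x₀ ∷ x) ≡
  ½ * (walsh t (f ∘ (false ∷_)) x - walsh t (f ∘ (true ∷_)) x)
transform-gadget {b} t f x₀ x = trans (mean-allΛ b (λ v → f v * sgn (gadget t (x₀ ∷ x) v)))
  (cong (λ q → ½ * (walsh t (f ∘ (false ∷_)) x + q))
    (trans (mean-cong (allΛ b) λ y → trans
       (cong (f (true ∷ y) *_) (sgn-xor true (ip (prefix t x) y)))
       (solve 2 (λ a c → a :* (con (- 1ℚ) :* c) := :- (a :* c)) refl (f (true ∷ y)) (sgn (ip (prefix t x) y))))
     (mean-neg (allΛ b) _)))

-- By ((p - q) / 2)² ≤ (p² + q²) / 2 the first bit does no harm, and the saving ½ ^ t from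
-- `parseval` on the two halves of `f` carries over to the gadget.
transform-energy : ∀ t b → t ℕ.≤ b → (f : Λ (suc b) → ℚ) →
  mean (allΛ (suc b)) (λ u → transform (gadget t) f u * transform (gadget t) f u)
    ≤ ½ ^ t * mean (allΛ (suc b)) (λ v → f v * f v)
transform-energy t b t≤b f = begin
  mean (allΛ (suc b)) (λ u → transform (gadget t) f u * transform (gadget t) f u)
    ≡⟨ mean-allΛ b (λ u → transform (gadget t) f u * transform (gadget t) f u) ⟩
  ½ * (mean (allΛ b) (T false) + mean (allΛ b) (T true))
    ≤⟨ *-monoˡ-≤ 0≤½ (+-mono-≤ (mean-mono (allΛ b) (bound false)) (mean-mono (allΛ b) (bound true))) ⟩
  ½ * (mean (allΛ b) D + mean (allΛ b) D)
    ≡⟨ solve 1 (λ p → con ½ :* (p :+ p) := p) refl (mean (allΛ b) D) ⟩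
  mean (allΛ b) D
    ≡⟨ mean-*ˡ (allΛ b) ½ (λ x → W₀ x * W₀ x + W₁ x * W₁ x) ⟩
  ½ * mean (allΛ b) (λ x → W₀ x * W₀ x + W₁ x * W₁ x)
    ≡⟨ cong (½ *_) (mean-+ (allΛ b) (λ x → W₀ x * W₀ x) (λ x → W₁ x * W₁ x)) ⟩
  ½ * (mean (allΛ b) (λ x → W₀ x * W₀ x) + mean (allΛ b) (λ x → W₁ x * W₁ x))
    ≤⟨ *-monoˡ-≤ 0≤½ (+-mono-≤ (parseval t b t≤b f₀) (parseval t b t≤b f₁)) ⟩
  ½ * (½ ^ t * S₀ + ½ ^ t * S₁)
    ≡⟨ solve 4 (λ h p a c → h :* (p :* a :+ p :* c) := p :* (h :* (a :+ c))) refl ½ (½ ^ t) S₀ S₁ ⟩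
  ½ ^ t * (½ * (S₀ + S₁))
    ≡⟨ cong (½ ^ t *_) (mean-allΛ b (λ y → f y * f y)) ⟨
  ½ ^ t * mean (allΛ (suc b)) (λ y → f y * f y)
    ∎
  where
  open ≤-Reasoning
  0≤½ : 0ℚ ≤ ½
  0≤½ = nonNegative⁻¹ ½
  f₀ = f ∘ (false ∷_)
  f₁ = f ∘ (true ∷_)
  W₀ = walsh t f₀
  W₁ = walsh t f₁
  S₀ = mean (allΛ b) (λ y → f₀ y * f₀ y)
  S₁ = mean (allΛ b) (λ y → f₁ y * f₁ y)
  T : Bool → Λ b → ℚ
  T x₀ x = transform (gadget t) f (x₀ ∷ x) * transform (gadget t) f (x₀ ∷ x)
  D : Λ b → ℚ
  D x = ½ * (W₀ x * W₀ x + W₁ x * W₁ x)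
  bound : ∀ x₀ x → T x₀ x ≤ D x
  bound x₀ x = subst₂ _≤_
    (trans (+-identityʳ _) (sym (cong₂ _*_ (transform-gadget t f x₀ x) (transform-gadget t f x₀ x))))
    (solve 2 (λ p q → (con ½ :* (p :- q)) :* (con ½ :* (p :- q)) :+ (con ½ :* (p :+ q)) :* (con ½ :* (p :+ q))
                   := con ½ :* (p :* p :+ q :* q)) refl (W₀ x) (W₁ x))
    (+-monoʳ-≤ (½ * (W₀ x - W₁ x) * (½ * (W₀ x - W₁ x))) (square-nonNeg (½ * (W₀ x + W₁ x))))

-- The weighted AM-GM inequality 2c·a·F ≤ c²·a² + F² replaces Cauchy–Schwarz,
-- which would need a square root.
correlation≤ : ∀ s b → s ℕ.+ s ℕ.≤ b → (a f : Λ (suc b) → ℚ) →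
  (∀ u → a u * a u ≤ 1ℚ) → (∀ v → f v * f v ≤ 1ℚ) →
  correlation (gadget (s ℕ.+ s)) a f ≤ ½ ^ s
correlation≤ s b 2s≤b a f a²≤1 f²≤1 = *-cancelˡ-≤ (positive⁻¹ 2ℚ) (*-cancelˡ-≤ (^-pos s (positive⁻¹ ½)) (begin
  c * (2ℚ * correlation g a f)
    ≡⟨ *-assoc c 2ℚ _ ⟨
  c * 2ℚ * correlation g a f
    ≡⟨ mean-*ˡ Ω (c * 2ℚ) (λ u → a u * transform g f u) ⟨
  mean Ω (λ u → c * 2ℚ * (a u * transform g f u))
    ≤⟨ mean-mono Ω (λ u → am-gm (a u) (transform g f u) (a²≤1 u)) ⟩
  mean Ω (λ u → c * c + transform g f u * transform g f u)
    ≡⟨ mean-+ Ω (λ _ → c * c) (λ u → transform g f u * transform g f u) ⟩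
  mean Ω (λ _ → c * c) + mean Ω (λ u → transform g f u * transform g f u)
    ≤⟨ +-mono-≤ (≤-reflexive (mean-const Ω {{allΛ-nonZero (suc b)}} (c * c))) (transform-energy (s ℕ.+ s) b 2s≤b f) ⟩
  c * c + ½ ^ (s ℕ.+ s) * mean Ω (λ v → f v * f v)
    ≤⟨ +-monoʳ-≤ (c * c) (*-monoˡ-≤ (^-nonNeg (s ℕ.+ s) (nonNegative⁻¹ ½)) energy≤1) ⟩
  c * c + ½ ^ (s ℕ.+ s) * 1ℚ
    ≡⟨ cong (λ p → c * c + p * 1ℚ) (^-homo-* ½ s s) ⟩
  c * c + c * c * 1ℚ
    ≡⟨ solve 1 (λ c → c :* c :+ c :* c :* con 1ℚ := c :* (con 2ℚ :* c)) refl c ⟩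
  c * (2ℚ * c)
    ∎))
  where
  open ≤-Reasoning
  -- The weight balances both sides: the energy of the transform is at most ½ ^ (2 s) = c².
  c = ½ ^ s
  Ω = allΛ (suc b)
  g : Gadget (suc b)
  g = gadget (s ℕ.+ s)
  energy≤1 : mean Ω (λ v → f v * f v) ≤ 1ℚ
  energy≤1 = ≤-trans (mean-mono Ω f²≤1) (≤-reflexive (mean-const Ω {{allΛ-nonZero (suc b)}} 1ℚ))
  am-gm : ∀ p q → p * p ≤ 1ℚ → c * 2ℚ * (p * q) ≤ c * c + q * q
  am-gm p q p²≤1 = begin
    c * 2ℚ * (p * q)
      ≡⟨ +-identityʳ _ ⟨
    c * 2ℚ * (p * q) + 0ℚ
      ≤⟨ +-monoʳ-≤ (c * 2ℚ * (p * q)) (square-nonNeg (c * p - q)) ⟩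
    c * 2ℚ * (p * q) + (c * p - q) * (c * p - q)
      ≡⟨ solve 3 (λ c p q → c :* con 2ℚ :* (p :* q) :+ (c :* p :- q) :* (c :* p :- q)
                     := c :* c :* (p :* p) :+ q :* q) refl c p q ⟩
    c * c * (p * p) + q * q
      ≤⟨ +-monoˡ-≤ (q * q) (*-monoˡ-≤ (square-nonNeg c) p²≤1) ⟩
    c * c * 1ℚ + q * q
      ≡⟨ cong (_+ q * q) (*-identityʳ (c * c)) ⟩
    c * c + q * q
      ∎

-- Discrepancy

opaque
  unfolding mean

  PrUV≡mean : ∀ (e : Λ b → Λ b → Bool) → PrUV e ≡ mean (allΛ b) (λ u → mean (allΛ b) (λ v → ind (e u v)))
  PrUV≡mean {b} e = begin
    PrUV e
      ≡⟨ k/n≡k*recip (length (filterᵇ (uncurry e) pairs)) (2 ℕ.^ b ℕ.* 2 ℕ.^ b)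
           {{ℕ.m*n≢0 (2 ℕ.^ b) (2 ℕ.^ b) {{ℕ.m^n≢0 2 b}} {{ℕ.m^n≢0 2 b}}}} ⟩
    ⟦ + length (filterᵇ (uncurry e) pairs) ⟧ * recip (2 ℕ.^ b ℕ.* 2 ℕ.^ b)
      ≡⟨ cong₂ (λ p n → p * recip n) (length-filterᵇ (uncurry e) pairs)
           (sym (trans (length-cartesian _,_ (allΛ b) (allΛ b)) (cong₂ ℕ._*_ (length-allΛ b) (length-allΛ b)))) ⟩
    mean pairs (ind ∘ uncurry e)
      ≡⟨ mean-cartesian _,_ (allΛ b) (allΛ b) (ind ∘ uncurry e) ⟩
    mean (allΛ b) (λ u → mean (allΛ b) (λ v → ind (e u v)))
      ∎
    where
    pairs : List (Λ b × Λ b)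
    pairs = cartesianProduct (allΛ b) (allΛ b)
    open ≡-Reasoning

-- The indicator of g = 0 minus that of g = 1 is the sign of g, and the indicator of a rectangle is
-- a product.
discOn≡correlation : ∀ (g : Gadget b) A B → discOn g (A , B) ≡ ∣ correlation g (ind ∘ A) (ind ∘ B) ∣
discOn≡correlation {b} g A B = cong ∣_∣ (begin
  PrUV (λ u v → not (g u v) ∧ (A u ∧ B v)) - PrUV (λ u v → g u v ∧ (A u ∧ B v))
    ≡⟨ cong₂ _-_ (PrUV≡mean (λ u v → not (g u v) ∧ (A u ∧ B v))) (PrUV≡mean (λ u v → g u v ∧ (A u ∧ B v))) ⟩
  mean Ω (λ u → mean Ω (zeros u)) - mean Ω (λ u → mean Ω (ones u))
    ≡⟨ mean-minus Ω (λ u → mean Ω (zeros u)) (λ u → mean Ω (ones u)) ⟨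
  mean Ω (λ u → mean Ω (zeros u) - mean Ω (ones u))
    ≡⟨ mean-cong Ω row ⟩
  correlation g (ind ∘ A) (ind ∘ B)
    ∎)
  where
  open ≡-Reasoning
  Ω = allΛ b
  zeros ones : Λ b → Λ b → ℚ
  zeros u v = ind (not (g u v) ∧ (A u ∧ B v))
  ones  u v = ind (g u v ∧ (A u ∧ B v))
  signed : ∀ z p q → ind (not z ∧ (p ∧ q)) - ind (z ∧ (p ∧ q)) ≡ ind p * (ind q * sgn z)
  signed false false q = sym (*-zeroˡ (ind q * 1ℚ))
  signed true  false q = sym (*-zeroˡ (ind q * - 1ℚ))
  signed false true false = refl
  signed true  true false = refl
  signed false true true  = refl
  signed true  true true  = refl
  row : ∀ u → mean Ω (zeros u) - mean Ω (ones u) ≡ ind (A u) * transform g (ind ∘ B) u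
  row u = begin
    mean Ω (zeros u) - mean Ω (ones u)               ≡⟨ mean-minus Ω (zeros u) (ones u) ⟨
    mean Ω (λ v → zeros u v - ones u v)              ≡⟨ mean-cong Ω (λ v → signed (g u v) (A u) (B v)) ⟩
    mean Ω (λ v → ind (A u) * (ind (B v) * sgn (g u v)))  ≡⟨ mean-*ˡ Ω (ind (A u)) (λ v → ind (B v) * sgn (g u v)) ⟩
    ind (A u) * transform g (ind ∘ B) u              ∎

correlation-cong : ∀ (g : Gadget b) {a a′ f f′} → (∀ u → a u ≡ a′ u) → (∀ v → f v ≡ f′ v) →
  correlation g a f ≡ correlation g a′ f′
correlation-cong {b} g a≗a′ f≗f′ = mean-cong (allΛ b) λ u →
  cong₂ _*_ (a≗a′ u) (mean-cong (allΛ b) λ v → cong (_* sgn (g u v)) (f≗f′ v))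

-- Bounds the absolute value from the one-sided `correlation≤`. For this the latter speaks of
-- functions with a² ≤ 1 and not just of indicators.
correlation-neg : ∀ (g : Gadget b) a f → correlation g (λ u → - a u) f ≡ - correlation g a f
correlation-neg {b} g a f = trans
  (mean-cong (allΛ b) λ u → sym (neg-distribˡ-* (a u) (transform g f u)))
  (mean-neg (allΛ b) (λ u → a u * transform g f u))

-- Predicates are functions, so a given one is listed only up to pointwise equality;
-- `correlation-cong` bridges the difference.
allPredicates-complete : ∀ b (A : Λ b → Bool) → ∃[ A′ ] (A′ ∈ allPredicates b × (∀ x → A′ x ≡ A x))
allPredicates-complete zero A with A [] in eq
... | false = _ , here refl , λ { [] → sym eq }
... | true  = _ , there (here refl) , λ { [] → sym eq }
allPredicates-complete (suc b) A with allPredicates-complete b (A ∘ (false ∷_))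
   | allPredicates-complete b (A ∘ (true ∷_))
... | p , p∈ , p≗ | q , q∈ , q≗ = _ , ∈-cartesianProductWith⁺ _ p∈ q∈ ,
  λ { (false ∷ x) → p≗ x ; (true ∷ x) → q≗ x }

discOn≤disc : ∀ (g : Gadget b) A B → discOn g (A , B) ≤ disc g
discOn≤disc {b} g A B = begin
  discOn g (A , B)                          ≡⟨ discOn≡correlation g A B ⟩
  ∣ correlation g (ind ∘ A) (ind ∘ B) ∣     ≡⟨ cong ∣_∣ (correlation-cong g (λ u → cong ind (A′≗A u))
                                                               (λ v → cong ind (B′≗B v))) ⟨
  ∣ correlation g (ind ∘ A′) (ind ∘ B′) ∣   ≡⟨ discOn≡correlation g A′ B′ ⟨
  discOn g (A′ , B′)                        ≤⟨ All.lookup (xs≤max 0ℚ _)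
                                                 (∈-map⁺ (discOn g) (∈-cartesianProduct⁺ A′∈ B′∈)) ⟩
  disc g                                    ∎
  where
  open ≤-Reasoning
  A′ B′ : Λ b → Bool
  A′ = proj₁ (allPredicates-complete b A)
  B′ = proj₁ (allPredicates-complete b B)
  A′∈ : A′ ∈ allPredicates b
  A′∈ = proj₁ (proj₂ (allPredicates-complete b A))
  B′∈ : B′ ∈ allPredicates b
  B′∈ = proj₁ (proj₂ (allPredicates-complete b B))
  A′≗A : ∀ x → A′ x ≡ A x
  A′≗A = proj₂ (proj₂ (allPredicates-complete b A))
  B′≗B : ∀ x → B′ x ≡ B x
  B′≗B = proj₂ (proj₂ (allPredicates-complete b B))

disc-least : ∀ (g : Gadget b) {p} → 0ℚ ≤ p → (∀ R → discOn g R ≤ p) → disc g ≤ p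
disc-least {b} g {p} 0≤p R≤p = max≤v⁺ {v = p} {⊥ = 0ℚ} {xs = List.map (discOn g) rectangles} 0≤p
  (All.map⁺ {P = _≤ p} {f = discOn g} (All.universal R≤p rectangles))
  where rectangles = cartesianProduct (allPredicates b) (allPredicates b)

disc≤ : ∀ s b → s ℕ.+ s ℕ.≤ b → disc {suc b} (gadget (s ℕ.+ s)) ≤ ½ ^ s
disc≤ s b 2s≤b = disc-least g (^-nonNeg s (nonNegative⁻¹ ½)) bound
  where
  g : Gadget (suc b)
  g = gadget (s ℕ.+ s)
  ind²≤1 : ∀ a → ind a * ind a ≤ 1ℚ
  ind²≤1 true  = ≤-refl
  ind²≤1 false = nonNegative⁻¹ 1ℚ
  -ind²≤1 : ∀ a → - ind a * - ind a ≤ 1ℚ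
  -ind²≤1 true  = ≤-refl
  -ind²≤1 false = nonNegative⁻¹ 1ℚ
  bound : ∀ R → discOn g R ≤ ½ ^ s
  bound (A , B) = begin
    discOn g (A , B)                        ≡⟨ discOn≡correlation g A B ⟩
    ∣ correlation g (ind ∘ A) (ind ∘ B) ∣
      ≤⟨ ∣p∣≤q (correlation≤ s b 2s≤b (ind ∘ A) (ind ∘ B) (ind²≤1 ∘ A) (ind²≤1 ∘ B))
           (subst (_≤ ½ ^ s) (correlation-neg g (ind ∘ A) (ind ∘ B))
             (correlation≤ s b 2s≤b (λ u → - ind (A u)) (ind ∘ B) (-ind²≤1 ∘ A) (ind²≤1 ∘ B))) ⟩
    ½ ^ s                                   ∎
    where open ≤-Reasoning

-- Orthogonality of characters: the transform of 1 is 1 where the first `t` bits of x vanish and 0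
-- elsewhere.
mean-walsh-1 : ∀ t b → t ℕ.≤ b → mean (allΛ b) (walsh t (λ _ → 1ℚ)) ≡ ½ ^ t
mean-walsh-1 zero b _ = trans
  (mean-cong (allΛ b) (λ _ → mean-const (allΛ b) {{allΛ-nonZero b}} 1ℚ))
  (mean-const (allΛ b) {{allΛ-nonZero b}} 1ℚ)
mean-walsh-1 (suc t) (suc b) (ℕ.s≤s t≤b) = begin
  mean (allΛ (suc b)) (walsh (suc t) (λ _ → 1ℚ))
    ≡⟨ mean-allΛ b (walsh (suc t) (λ _ → 1ℚ)) ⟩
  ½ * (mean (allΛ b) (λ x → walsh (suc t) (λ _ → 1ℚ) (false ∷ x))
     + mean (allΛ b) (λ x → walsh (suc t) (λ _ → 1ℚ) (true ∷ x)))
    ≡⟨ cong (½ *_) (cong₂ _+_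
         (mean-cong (allΛ b) λ x → trans (walsh-suc t (λ _ → 1ℚ) false x)
           (solve 1 (λ w → con ½ :* (w :+ con 1ℚ :* w) := w) refl (W x)))
         (mean-cong (allΛ b) λ x → trans (walsh-suc t (λ _ → 1ℚ) true x)
           (solve 1 (λ w → con ½ :* (w :+ con (- 1ℚ) :* w) := con 0ℚ) refl (W x)))) ⟩
  ½ * (mean (allΛ b) W + mean (allΛ b) (λ _ → 0ℚ))
    ≡⟨ cong (½ *_) (cong₂ _+_ (mean-walsh-1 t b t≤b) (mean-const (allΛ b) {{allΛ-nonZero b}} 0ℚ)) ⟩
  ½ * (½ ^ t + 0ℚ)
    ≡⟨ cong (½ *_) (+-identityʳ (½ ^ t)) ⟩
  ½ ^ suc t
    ∎
  where
  open ≡-Reasoning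
  W : Λ b → ℚ
  W = walsh t (λ _ → 1ℚ)

correlation≤disc : ∀ (g : Gadget b) A B → correlation g (ind ∘ A) (ind ∘ B) ≤ disc g
correlation≤disc g A B = ≤-trans (p≤∣p∣ (correlation g (ind ∘ A) (ind ∘ B)))
  (subst (_≤ disc g) (discOn≡correlation g A B) (discOn≤disc g A B))

-- Witnessed by the rectangle of all pairs (u , v) such that v begins with 0.
≤disc : ∀ t b → t ℕ.≤ b → ½ ^ suc t ≤ disc {suc b} (gadget t)
≤disc t b t≤b = begin
  ½ ^ suc t
    ≡⟨ cong (½ *_) (mean-walsh-1 t b t≤b) ⟨
  ½ * mean (allΛ b) W
    ≡⟨ mean-*ˡ (allΛ b) ½ W ⟨
  mean (allΛ b) (λ x → ½ * W x)
    ≡⟨ solve 1 (λ p → p := con ½ :* (p :+ p)) refl (mean (allΛ b) (λ x → ½ * W x)) ⟩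
  ½ * (mean (allΛ b) (λ x → ½ * W x) + mean (allΛ b) (λ x → ½ * W x))
    ≡⟨ cong₂ (λ p q → ½ * (p + q)) (mean-cong (allΛ b) (row false)) (mean-cong (allΛ b) (row true)) ⟨
  ½ * (mean (allΛ b) (λ x → 1ℚ * T (false ∷ x)) + mean (allΛ b) (λ x → 1ℚ * T (true ∷ x)))
    ≡⟨ mean-allΛ b (λ u → 1ℚ * T u) ⟨
  correlation g (ind ∘ everything) (ind ∘ begins0)
    ≤⟨ correlation≤disc g everything begins0 ⟩
  disc g
    ∎
  where
  open ≤-Reasoning
  everything begins0 : Λ (suc b) → Bool
  everything _ = true
  begins0 v = not (Vec.head v)
  g : Gadget (suc b)
  g = gadget t
  W : Λ b → ℚ
  W = walsh t (λ _ → 1ℚ)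
  T : Λ (suc b) → ℚ
  T = transform g (ind ∘ begins0)
  W₀ W₁ : Λ b → ℚ
  W₀ = walsh t (λ y → ind (begins0 (false ∷ y)))
  W₁ = walsh t (λ y → ind (begins0 (true ∷ y)))
  W₀≡W : ∀ x → W₀ x ≡ W x
  W₀≡W x = refl
  W₁≡0 : ∀ x → W₁ x ≡ 0ℚ
  W₁≡0 x = trans (mean-cong (allΛ b) (λ y → *-zeroˡ (sgn (ip (prefix t x) y))))
    (mean-const (allΛ b) {{allΛ-nonZero b}} 0ℚ)
  row : ∀ x₀ x → 1ℚ * T (x₀ ∷ x) ≡ ½ * W x
  row x₀ x = begin-equality
    1ℚ * T (x₀ ∷ x)        ≡⟨ *-identityˡ (T (x₀ ∷ x)) ⟩
    T (x₀ ∷ x)             ≡⟨ transform-gadget t (ind ∘ begins0) x₀ x ⟩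
    ½ * (W₀ x - W₁ x)      ≡⟨ cong₂ (λ p q → ½ * (p - q)) (W₀≡W x) (W₁≡0 x) ⟩
    ½ * (W x - 0ℚ)         ≡⟨ solve 1 (λ w → con ½ :* (w :- con 0ℚ) := con ½ :* w) refl (W x) ⟩
    ½ * W x                ∎

-- Independent uniform pairs

module _ (xs : List A) (ys : List B)
         .{{_ : ℕ.NonZero (length xs)}} .{{_ : ℕ.NonZero (length ys)}} where

  pairs-nonZero : ℕ.NonZero (length (cartesianProduct xs ys))
  pairs-nonZero = subst ℕ.NonZero (sym (length-cartesian _,_ xs ys)) (ℕ.m*n≢0 (length xs) (length ys))

  pairSpace : ProbSpace
  pairSpace = uniform (cartesianProduct xs ys) {{pairs-nonZero}}

  first : RV pairSpace A
  first ω = proj₁ (List.lookup (cartesianProduct xs ys) ω)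

  second : RV pairSpace B
  second ω = proj₂ (List.lookup (cartesianProduct xs ys) ω)

  Pr-first∧second : ∀ (e : A → Bool) (f : B → Bool) →
    Pr pairSpace (λ ω → e (first ω) ∧ f (second ω)) ≡ mean xs (ind ∘ e) * mean ys (ind ∘ f)
  Pr-first∧second e f = begin
    Pr pairSpace (λ ω → e (first ω) ∧ f (second ω))
      ≡⟨ Pr-uniform (cartesianProduct xs ys) {{pairs-nonZero}} (λ (x , y) → e x ∧ f y) ⟩
    mean (cartesianProduct xs ys) (λ (x , y) → ind (e x ∧ f y))
      ≡⟨ mean-cartesian _,_ xs ys (λ (x , y) → ind (e x ∧ f y)) ⟩
    mean xs (λ x → mean ys (λ y → ind (e x ∧ f y)))
      ≡⟨ mean-cong xs (λ x → trans (mean-cong ys (λ y → ind-∧ (e x) (f y))) (mean-*ˡ ys (ind (e x)) (ind ∘ f))) ⟩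
    mean xs (λ x → ind (e x) * mean ys (ind ∘ f))
      ≡⟨ mean-*ʳ xs (mean ys (ind ∘ f)) (ind ∘ e) ⟩
    mean xs (ind ∘ e) * mean ys (ind ∘ f)
      ∎
    where open ≡-Reasoning

  Pr-first : ∀ (e : A → Bool) → Pr pairSpace (λ ω → e (first ω)) ≡ mean xs (ind ∘ e)
  Pr-first e = begin
    Pr pairSpace (λ ω → e (first ω))
      ≡⟨ Pr-uniform (cartesianProduct xs ys) {{pairs-nonZero}} (e ∘ proj₁) ⟩
    mean (cartesianProduct xs ys) (ind ∘ e ∘ proj₁)
      ≡⟨ mean-cartesian _,_ xs ys (ind ∘ e ∘ proj₁) ⟩
    mean xs (λ x → mean ys (λ _ → ind (e x)))
      ≡⟨ mean-cong xs (λ x → mean-const ys (ind (e x))) ⟩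
    mean xs (ind ∘ e)
      ∎
    where open ≡-Reasoning

  Pr-second : ∀ (f : B → Bool) → Pr pairSpace (λ ω → f (second ω)) ≡ mean ys (ind ∘ f)
  Pr-second f = begin
    Pr pairSpace (λ ω → f (second ω))
      ≡⟨ Pr-uniform (cartesianProduct xs ys) {{pairs-nonZero}} (f ∘ proj₂) ⟩
    mean (cartesianProduct xs ys) (ind ∘ f ∘ proj₂)
      ≡⟨ mean-cartesian _,_ xs ys (ind ∘ f ∘ proj₂) ⟩
    mean xs (λ _ → mean ys (ind ∘ f))
      ≡⟨ mean-const xs (mean ys (ind ∘ f)) ⟩
    mean ys (ind ∘ f)
      ∎
    where open ≡-Reasoning

-- Transducers

module Transducer (out : Q → Λ b → Λ b) (next : Q → Λ b → Q) where

  run : Q → Vec (Λ b) n → Vec (Λ b) n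
  run q []       = []
  run q (w ∷ ws) = out q w ∷ run (next q w) ws

  module _ {p : ℚ} (0≤p : 0ℚ ≤ p)
           (out≤p : ∀ q u → mean (allΛ b) (λ w → ind (does (out q w ≟ᵇ u))) ≤ p) where

    -- The chain rule. Each block is produced from a fresh input block, and the bound for the later
    -- blocks is uniform in the state, so it can be pulled out of the mean over the current input.
    -- Blocks outside `S` merely advance the state.
    run-project≤ : ∀ q (S : Subset n) u →
      mean (allVecs (allΛ b) n) (λ ws → ind (does (project S (run q ws) ≟ˢ u))) ≤ p ^ card S
    run-project≤ {zero} q [] [] = ≤-reflexive
      (trans (mean-cong (allVecs (allΛ b) 0) λ { [] → refl }) (mean-const (allVecs (allΛ b) 0) 1ℚ))
    run-project≤ {suc n} q (outside ∷ S) u = begin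
      mean (allVecs (allΛ b) (suc n)) (λ ws → ind (does (project (outside ∷ S) (run q ws) ≟ˢ u)))
        ≡⟨ mean-allVecs (allΛ b) n (λ ws → ind (does (project (outside ∷ S) (run q ws) ≟ˢ u))) ⟩
      mean (allΛ b) (λ w → mean (allVecs (allΛ b) n) (λ ws → ind (does (project S (run (next q w) ws) ≟ˢ u))))
        ≤⟨ mean-mono (allΛ b) (λ w → run-project≤ (next q w) S u) ⟩
      mean (allΛ b) (λ _ → p ^ card S)
        ≡⟨ mean-const (allΛ b) {{allΛ-nonZero b}} (p ^ card S) ⟩
      p ^ card S
        ∎
      where open ≤-Reasoning
    run-project≤ {suc n} q (inside ∷ S) (u₀ ∷ u) = begin
      mean (allVecs (allΛ b) (suc n)) (λ ws → ind (does (project (inside ∷ S) (run q ws) ≟ˢ (u₀ ∷ u))))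
        ≡⟨ mean-allVecs (allΛ b) n (λ ws → ind (does (project (inside ∷ S) (run q ws) ≟ˢ (u₀ ∷ u)))) ⟩
      mean (allΛ b) (λ w → mean (allVecs (allΛ b) n) (λ ws → ind (does (out q w ≟ᵇ u₀) ∧ rest w ws)))
        ≡⟨ mean-cong (allΛ b) (λ w → trans
             (mean-cong (allVecs (allΛ b) n) (λ ws → ind-∧ (does (out q w ≟ᵇ u₀)) (rest w ws)))
             (mean-*ˡ (allVecs (allΛ b) n) (hit w) (ind ∘ rest w))) ⟩
      mean (allΛ b) (λ w → hit w * mean (allVecs (allΛ b) n) (ind ∘ rest w))
        ≤⟨ mean-mono (allΛ b) (λ w → *-monoˡ-≤ (ind-nonNeg (does (out q w ≟ᵇ u₀))) (run-project≤ (next q w) S u)) ⟩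
      mean (allΛ b) (λ w → hit w * p ^ card S)
        ≡⟨ mean-*ʳ (allΛ b) (p ^ card S) hit ⟩
      mean (allΛ b) hit * p ^ card S
        ≤⟨ *-monoʳ-≤ (^-nonNeg (card S) 0≤p) (out≤p q u₀) ⟩
      p * p ^ card S
        ∎
      where
      open ≤-Reasoning
      hit : Λ b → ℚ
      hit w = ind (does (out q w ≟ᵇ u₀))
      rest : Λ b → Vec (Λ b) n → Bool
      rest w ws = does (project S (run (next q w) ws) ≟ˢ u)


open Transducer using (run; run-project≤)

-- Presents the uniform X as a transducer with one state, so that `run-project≤` serves X as well as
-- Y.
run-id : ∀ (ws : Vec (Λ b) n) → run (λ _ w → w) (λ _ _ → tt) tt ws ≡ ws
run-id []       = refl
run-id (w ∷ ws) = cong (w ∷_) (run-id ws)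

½^b≤2½^b : ∀ b → ½ ^ b ≤ 2ℚ * ½ ^ b
½^b≤2½^b b = subst₂ _≤_ (+-identityʳ (½ ^ b)) (solve 1 (λ p → p :+ p := con 2ℚ :* p) refl (½ ^ b))
  (+-monoʳ-≤ (½ ^ b) (^-nonNeg b (nonNegative⁻¹ ½)))

-- A chunk z ∷ p stands for the equation g (_ ∷ p…) y = z, which is solved here
-- for the first bit of y.
impose : List Bool → Λ b → Λ b
impose p       []       = []
impose []      (w₀ ∷ w) = false ∷ w
impose (z ∷ p) (w₀ ∷ w) = (z xor ip p w) ∷ w

-- Only the first bit of a block is overwritten, also when the chunk is empty because the equations
-- have run out. Hitting `u` therefore forces the tail of `w`, and at most one bit of entropy is
-- lost.
impose-spread : ∀ p (u : Λ b) → mean (allΛ b) (λ w → ind (does (impose p w ≟ᵇ u))) ≤ 2ℚ * ½ ^ b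
impose-spread {zero} p [] = ≤-trans (mean-mono (allΛ 0) {g = λ _ → 1ℚ} (λ w → ind≤1 (does (impose p w ≟ᵇ []))))
  (≤-trans (≤-reflexive (mean-const (allΛ 0) 1ℚ)) (½^b≤2½^b 0))
impose-spread {suc b} p (u₀ ∷ u) = begin
  mean (allΛ (suc b)) (λ w → ind (does (impose p w ≟ᵇ (u₀ ∷ u))))
    ≡⟨ mean-allΛ b (λ w → ind (does (impose p w ≟ᵇ (u₀ ∷ u)))) ⟩
  ½ * (mean (allΛ b) (hit false) + mean (allΛ b) (hit true))
    ≤⟨ *-monoˡ-≤ (nonNegative⁻¹ ½)
         (+-mono-≤ (mean-mono (allΛ b) (tail-hit p false)) (mean-mono (allΛ b) (tail-hit p true))) ⟩
  ½ * (mean (allΛ b) (λ w → ind (does (w ≟ᵇ u))) + mean (allΛ b) (λ w → ind (does (w ≟ᵇ u))))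
    ≡⟨ cong (λ q → ½ * (q + q)) (mean-≟ b u) ⟩
  ½ * (½ ^ b + ½ ^ b)
    ≡⟨ solve 1 (λ q → con ½ :* (q :+ q) := con 2ℚ :* (con ½ :* q)) refl (½ ^ b) ⟩
  2ℚ * ½ ^ suc b
    ∎
  where
  open ≤-Reasoning
  hit : Bool → Λ b → ℚ
  hit w₀ w = ind (does (impose p (w₀ ∷ w) ≟ᵇ (u₀ ∷ u)))
  ind-∧≤ : ∀ x y → ind (x ∧ y) ≤ ind y
  ind-∧≤ true  y = ≤-refl
  ind-∧≤ false y = ind-nonNeg y
  tail-hit : ∀ p w₀ w → ind (does (impose p (w₀ ∷ w) ≟ᵇ (u₀ ∷ u))) ≤ ind (does (w ≟ᵇ u))
  tail-hit []      w₀ w = ind-∧≤ (does (false Bool.≟ u₀)) (does (w ≟ᵇ u))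
  tail-hit (z ∷ p) w₀ w = ind-∧≤ (does ((z xor ip p w) Bool.≟ u₀)) (does (w ≟ᵇ u))

-- The construction of Y

initial : ℕ → ∀ n → Subset n
initial zero    n       = ⊥
initial (suc m) zero    = []
initial (suc m) (suc n) = inside ∷ initial m n

card-initial : m ℕ.≤ n → card (initial m n) ≡ m
card-initial {n = n} ℕ.z≤n = ∣⊥∣≡0 n
  where open import Data.Fin.Subset.Properties using (∣⊥∣≡0)
card-initial (ℕ.s≤s m≤n) = cong suc (card-initial m≤n)

length-prefix≤ : ∀ t (x : Vec Bool b) → length (prefix t x) ℕ.≤ t
length-prefix≤ zero    x       = ℕ.z≤n
length-prefix≤ (suc t) []      = ℕ.z≤n
length-prefix≤ (suc t) (_ ∷ x) = ℕ.s≤s (length-prefix≤ t x)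

take-prefix : ∀ {t} → t ℕ.≤ b → (x : Vec Bool b) (r : List Bool) → List.take t (prefix t x ++ r) ≡ prefix t x
take-prefix ℕ.z≤n       x       r = refl
take-prefix (ℕ.s≤s t≤b) (a ∷ x) r = cong (a ∷_) (take-prefix t≤b x r)

drop-prefix : ∀ {t} → t ℕ.≤ b → (x : Vec Bool b) (r : List Bool) → List.drop t (prefix t x ++ r) ≡ r
drop-prefix ℕ.z≤n       x       r = refl
drop-prefix (ℕ.s≤s t≤b) (a ∷ x) r = drop-prefix t≤b x r

-- The length `card ⊥` is zero only propositionally, so these vectors cannot simply be matched
-- against the empty one.
⊥-vec-unique : ∀ n (u v : Vec A (card (⊥ {n}))) → u ≡ v
⊥-vec-unique zero    [] [] = refl
⊥-vec-unique (suc n) u  v  = ⊥-vec-unique n u v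

-- The padding `r` is exposed because it remains in the state while the equations are being read.
pad : ∀ (e : List Bool) → length e ℕ.≤ b → ∃[ r ] Σ[ v ∈ Λ b ] Vec.toList v ≡ e ++ r
pad {b} e e≤b = r , vec (e ++ r) (begin
  length (e ++ r)              ≡⟨ length-++ e ⟩
  length e ℕ.+ length r        ≡⟨ cong (length e ℕ.+_) (length-replicate (b ℕ.∸ length e)) ⟩
  length e ℕ.+ (b ℕ.∸ length e) ≡⟨ ℕ.m+[n∸m]≡n e≤b ⟩
  b                            ∎)
  where
  open ≡-Reasoning
  r = List.replicate (b ℕ.∸ length e) false
  vec : ∀ {b} (e : List Bool) → length e ≡ b → Σ[ v ∈ Λ b ] Vec.toList v ≡ e
  vec e refl = Vec.fromList e , toList∘fromList e

module _ (t : ℕ) where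

  -- The first block is copied and becomes the state; each later block is made
  -- to satisfy the next chunk (z , p) of the state, of length 1 + t.
  out : Maybe (List Bool) → Λ b → Λ b
  out nothing  w = w
  out (just p) w = impose (List.take (suc t) p) w

  next : Maybe (List Bool) → Λ b → Maybe (List Bool)
  next nothing  w = just (Vec.toList w)
  next (just p) w = just (List.drop (suc t) p)

  out-spread : ∀ q (u : Λ b) → mean (allΛ b) (λ w → ind (does (out q w ≟ᵇ u))) ≤ 2ℚ * ½ ^ b
  out-spread {b} nothing  u = ≤-trans (≤-reflexive (mean-≟ b u)) (½^b≤2½^b b)
  out-spread     (just p) u = impose-spread (List.take (suc t) p) u

  -- The message that the first block has to spell for the later blocks to give the answers `z`.
  code : ∀ m (xs : Vec (Λ (suc b)) n) → Vec Bool (card (initial m n)) → List Bool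
  code zero    xs       z        = []
  code (suc m) []       z        = []
  code (suc m) (x ∷ xs) (z₀ ∷ z) = z₀ ∷ prefix t (Vec.tail x) ++ code m xs z

  length-code≤ : ∀ m (xs : Vec (Λ (suc b)) n) z → length (code m xs z) ℕ.≤ m ℕ.* suc t
  length-code≤ zero    xs       z        = ℕ.z≤n
  length-code≤ (suc m) []       z        = ℕ.z≤n
  length-code≤ (suc m) (x ∷ xs) (z₀ ∷ z) = ℕ.s≤s (ℕ.≤-trans
    (ℕ.≤-reflexive (length-++ (prefix t (Vec.tail x))))
    (ℕ.+-mono-≤ (length-prefix≤ t (Vec.tail x)) (length-code≤ m xs z)))

  -- The imposed bit contains the inner product, which cancels against that of the gadget. As
  -- `t ≤ b`, each chunk has exactly 1 + t bits and the cuts made by `out` and `next` stay aligned.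
  -- The claim is for every `ws`: the message determines the answers whatever the remaining
  -- randomness.
  decode : t ℕ.≤ b → ∀ m (xs : Vec (Λ (suc b)) n) z r (ws : Vec (Λ (suc b)) n) →
    zipWith (gadget t) (project (initial m n) xs)
      (project (initial m n) (run out next (just (code m xs z ++ r)) ws)) ≡ z
  decode {n = n} t≤b zero xs z r ws = ⊥-vec-unique n _ z
  decode t≤b (suc m) [] [] r [] = refl
  decode t≤b (suc m) ((x₀ ∷ x) ∷ xs) (z₀ ∷ z) r ((w₀ ∷ w) ∷ ws) = cong₂ _∷_ solved later
    where
    open ≡-Reasoning
    chunk : List.take t ((prefix t x ++ code m xs z) ++ r) ≡ prefix t x
    chunk = trans (cong (List.take t) (++-assoc (prefix t x) (code m xs z) r)) (take-prefix t≤b x _)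
    remainder : List.drop t ((prefix t x ++ code m xs z) ++ r) ≡ code m xs z ++ r
    remainder = trans (cong (List.drop t) (++-assoc (prefix t x) (code m xs z) r)) (drop-prefix t≤b x _)
    solved : (z₀ xor ip (List.take t ((prefix t x ++ code m xs z) ++ r)) w) xor ip (prefix t x) w ≡ z₀
    solved = begin
      (z₀ xor ip (List.take t ((prefix t x ++ code m xs z) ++ r)) w) xor ip (prefix t x) w
        ≡⟨ cong (λ p → (z₀ xor ip p w) xor ip (prefix t x) w) chunk ⟩
      (z₀ xor ip (prefix t x) w) xor ip (prefix t x) w
        ≡⟨ xor-assoc z₀ (ip (prefix t x) w) (ip (prefix t x) w) ⟩
      z₀ xor (ip (prefix t x) w xor ip (prefix t x) w)
        ≡⟨ cong (z₀ xor_) (xor-same (ip (prefix t x) w)) ⟩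
      z₀ xor false
        ≡⟨ xor-identityʳ z₀ ⟩
      z₀
        ∎
    later : zipWith (gadget t) (project (initial m _) xs)
      (project (initial m _) (run out next (just (List.drop t ((prefix t x ++ code m xs z) ++ r))) ws)) ≡ z
    later = trans
      (cong (λ p → zipWith (gadget t) (project (initial m _) xs)
              (project (initial m _) (run out next (just p) ws))) remainder)
      (decode t≤b m xs z r ws)

  solving-block : t ℕ.≤ b → ∀ m → m ℕ.* suc t ℕ.≤ suc b →
    (xs : Vec (Λ (suc b)) n) (z : Vec Bool (card (initial m n))) →
    Σ[ v ∈ Λ (suc b) ] (∀ ws → zipWith (gadget t) (project (initial m n) xs)
      (project (initial m n) (run out next (just (Vec.toList v)) ws)) ≡ z)
  solving-block t≤b m m[1+t]≤b xs z =
    let r , v , v≡ = pad (code m xs z) (ℕ.≤-trans (length-code≤ m xs z) m[1+t]≤b) in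
    v , λ ws → trans
      (cong (λ p → zipWith (gadget t) (project (initial m _) xs)
              (project (initial m _) (run out next (just p) ws))) v≡)
      (decode t≤b m xs z r ws)

-- Estimates for Δ, √b and their products

infix 4 _isBetween_and_

-- All that is used about the real number Δ from here on. Disjointness is a field because `Cut` does
-- not bundle its axioms.
record _isBetween_and_ (D : Cut) (s u : ℕ) : Set where
  field
    lower⁺   : ∀ {q} → q < ⟦ + s ⟧ → lower D q
    upper⁺   : ∀ {q} → ⟦ + u ⟧ < q → upper D q
    disjoint : ∀ {q r} → lower D q → upper D r → q < r

  upper⁻ : ∀ {q} → upper D q → ⟦ + s ⟧ ≤ q
  upper⁻ D<q = ≮⇒≥ λ q<s → <-irrefl refl (disjoint (lower⁺ q<s) D<q)

  lower⁻ : ∀ {q} → lower D q → q ≤ ⟦ + u ⟧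
  lower⁻ q<D = ≮⇒≥ λ u<q → <-irrefl refl (disjoint q<D (upper⁺ u<q))

square-cancel-< : ∀ {p q} → 0ℚ ≤ q → p * p < q * q → p < q
square-cancel-< {p} {q} 0≤q p²<q² = ≰⇒> λ q≤p →
  <-irrefl refl (<-≤-trans p²<q² (*-mono-≤ 0≤q (≤-trans 0≤q q≤p) q≤p q≤p))

⟦m*n⟧ : ∀ m n → ⟦ + m ⟧ * ⟦ + n ⟧ ≡ ⟦ + (m ℕ.* n) ⟧
⟦m*n⟧ m n = trans (⟦⟧-homo-* (+ m) (+ n)) (cong ⟦_⟧ (sym (ℤ.pos-* m n)))

<-by : ∀ {p q} e → 0ℚ < e → p + e ≡ q → p < q
<-by {p} e 0<e p+e≡q = subst₂ _<_ (+-identityʳ p) p+e≡q (+-monoʳ-< p 0<e)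

*-monoˡ-<-≤ : ∀ {p q r s} → 0ℚ ≤ p → 0ℚ < s → p < q → r ≤ s → p * r < q * s
*-monoˡ-<-≤ 0≤p 0<s p<q r≤s = ≤-<-trans (*-monoˡ-≤ 0≤p r≤s) (*-monoʳ-< 0<s p<q)

module _ {b s : ℕ} where

  upper-√ : 100 ℕ.* (s ℕ.* s) ℕ.≤ b → ∀ {q} → upper (√ b) q → ⟦ + (10 ℕ.* s) ⟧ < q
  upper-√ 100s²≤b {q} (0<q , b<q²) = square-cancel-< (<⇒≤ 0<q) (begin-strict
    ⟦ + (10 ℕ.* s) ⟧ * ⟦ + (10 ℕ.* s) ⟧     ≡⟨ ⟦m*n⟧ (10 ℕ.* s) (10 ℕ.* s) ⟩
    ⟦ + ((10 ℕ.* s) ℕ.* (10 ℕ.* s)) ⟧       ≤⟨ ℕ-mono-≤ (subst (ℕ._≤ b) (eq s) 100s²≤b) ⟩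
    ⟦ + b ⟧                                 ≡⟨ i/1≡⟦i⟧ (+ b) ⟨
    + b / 1                                 <⟨ b<q² ⟩
    q * q                                   ∎)
    where
    open ≤-Reasoning
    eq : ∀ s → 100 ℕ.* (s ℕ.* s) ≡ (10 ℕ.* s) ℕ.* (10 ℕ.* s)
    eq = solve-∀

  upper-*√ : 100 ℕ.* (s ℕ.* s) ℕ.≤ b → ∀ {p} → 0ℚ ≤ p → ∀ {q} → upper (fromℚ p *ʳ √ b) q → p * ⟦ + (10 ℕ.* s) ⟧ < q
  upper-*√ 100s²≤b {p} 0≤p {q} (_ , b′ , _ , d , _ , p<b′ , _ , √<d , _ , _ , _ , b′d<q) =
    <-trans (*-monoˡ-<-≤ 0≤p (proj₁ √<d) p<b′ (<⇒≤ (upper-√ 100s²≤b √<d))) b′d<q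

  -- The lower end `c` of the box around √b may be negative, and its sign selects the corner: b′ c ≤
  -- 0 if c ≤ 0, and a c ≤ p c otherwise.
  lower-*√ : b ℕ.< 100 ℕ.* (suc s ℕ.* suc s) → ∀ {p} → 0ℚ < p → ∀ {q} → lower (fromℚ p *ʳ √ b) q →
    q < p * ⟦ + (10 ℕ.* suc s) ⟧
  lower-*√ b<100s² {p} 0<p {q} (a , b′ , c , _ , a<p , p<b′ , c<√ , _ , q<ac , _ , q<b′c , _) = bound c<√
    where
    t = ⟦ + (10 ℕ.* suc s) ⟧
    0≤t : 0ℚ ≤ t
    0≤t = nonNegative⁻¹ t
    nonPos-case : c ≤ 0ℚ → q < p * t
    nonPos-case c≤0 = <-≤-trans q<b′c (≤-trans
      (subst (b′ * c ≤_) (*-zeroʳ b′) (*-monoˡ-≤ (<⇒≤ (<-trans 0<p p<b′)) c≤0))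
      (*-nonNeg (<⇒≤ 0<p) 0≤t))
    c<t : c * c < + b / 1 → c < t
    c<t c²<b = square-cancel-< 0≤t (begin-strict
      c * c                                            <⟨ c²<b ⟩
      + b / 1                                          ≡⟨ i/1≡⟦i⟧ (+ b) ⟩
      ⟦ + b ⟧                                          <⟨ ⟦⟧-mono-< (ℤ.+<+ (subst (b ℕ.<_) (eq (suc s)) b<100s²)) ⟩
      ⟦ + ((10 ℕ.* suc s) ℕ.* (10 ℕ.* suc s)) ⟧        ≡⟨ ⟦m*n⟧ (10 ℕ.* suc s) (10 ℕ.* suc s) ⟨
      t * t                                            ∎)
      where
      open ≤-Reasoning
      eq : ∀ s → 100 ℕ.* (s ℕ.* s) ≡ (10 ℕ.* s) ℕ.* (10 ℕ.* s)
      eq = solve-∀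
    bound : lower (√ b) c → q < p * t
    bound (inj₁ c<0) = nonPos-case (<⇒≤ c<0)
    bound (inj₂ c²<b) with ≤-total 0ℚ c
    ... | inj₂ c≤0 = nonPos-case c≤0
    ... | inj₁ 0≤c = <-≤-trans q<ac (≤-trans (*-monoʳ-≤ 0≤c (<⇒≤ a<p)) (*-monoˡ-≤ (<⇒≤ 0<p) (<⇒≤ (c<t c²<b))))

-- From √b < 10 (s + 1) ≤ 20 s and s ≤ Δ.
1/20 : ℚ
1/20 = + 1 / 20

module _ {D : Cut} {s u : ℕ} (D-bounds : D isBetween s and u) where
  open _isBetween_and_ D-bounds

  √b/20≤D : ∀ {b} → 1 ℕ.≤ s → b ℕ.< 100 ℕ.* (suc s ℕ.* suc s) → fromℚ 1/20 *ʳ (√ b) ≤ʳ D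
  √b/20≤D 1≤s b<100[1+s]² (q , D<q , q<√b/20) = <-irrefl refl (begin-strict
    q                                         <⟨ lower-*√ {s = s} b<100[1+s]² (positive⁻¹ 1/20) q<√b/20 ⟩
    1/20 * ⟦ + (10 ℕ.* suc s) ⟧               ≤⟨ *-monoˡ-≤ (nonNegative⁻¹ 1/20) (ℕ-mono-≤ 10[1+s]≤20s) ⟩
    1/20 * ⟦ + (20 ℕ.* s) ⟧                   ≡⟨ cong (1/20 *_) (⟦m*n⟧ 20 s) ⟨
    1/20 * (⟦ + 20 ⟧ * ⟦ + s ⟧)               ≡⟨ *-assoc 1/20 ⟦ + 20 ⟧ ⟦ + s ⟧ ⟨
    1ℚ * ⟦ + s ⟧                              ≡⟨ *-identityˡ ⟦ + s ⟧ ⟩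
    ⟦ + s ⟧                                   ≤⟨ upper⁻ D<q ⟩
    q                                         ∎)
    where
    open ≤-Reasoning
    10[1+s]≤20s : 10 ℕ.* suc s ℕ.≤ 20 ℕ.* s
    10[1+s]≤20s = ℕ.≤-trans (ℕ.*-monoʳ-≤ 10 (ℕ.+-monoˡ-≤ s 1≤s)) (ℕ.≤-reflexive (eq s))
      where
      eq : ∀ s → 10 ℕ.* (s ℕ.+ s) ≡ 20 ℕ.* s
      eq = solve-∀

  D≤√b : ∀ {b} → u ℕ.≤ 10 ℕ.* s → 100 ℕ.* (s ℕ.* s) ℕ.≤ b → D ≤ʳ fromℚ 1ℚ *ʳ (√ b)
  D≤√b u≤10s 100s²≤b (q , √b<q , q<D) = <-irrefl refl (begin-strict
    q                              ≤⟨ lower⁻ q<D ⟩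
    ⟦ + u ⟧                        ≤⟨ ℕ-mono-≤ u≤10s ⟩
    ⟦ + (10 ℕ.* s) ⟧               ≡⟨ *-identityˡ ⟦ + (10 ℕ.* s) ⟧ ⟨
    1ℚ * ⟦ + (10 ℕ.* s) ⟧          <⟨ upper-*√ {s = s} 100s²≤b (nonNegative⁻¹ 1ℚ) √b<q ⟩
    q                              ∎)
    where open ≤-Reasoning

  -- The factors D are not cancelled algebraically. Following the largest corner through the three
  -- nested boxes, 2 < 2 d₃ r ≤ b₃ d₃ d₂ < b₂ d₂ < b₁, where r < d₂ by disjointness.
  upper-2/D*D*k : 1 ℕ.≤ s → ∀ k {q} → upper ((fromℕ 2 /ʳ D) *ʳ D *ʳ fromℕ k) q → 2ℚ * ⟦ + k ⟧ < q
  upper-2/D*D*k 1≤s k {q}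
    (_ , b₁ , _ , d₁ , _ ,
        (_ , b₂ , _ , d₂ , _ ,
          (_ , b₃ , _ , d₃ , _ , 2<b₃ , _ , (r , 0<r , r<D , 1<d₃r) , _ , _ , _ , b₃d₃<b₂)
        , _ , D<d₂ , _ , _ , _ , b₂d₂<b₁)
      , _ , k<d₁ , _ , _ , _ , b₁d₁<q) =
    ≤-<-trans (*-mono-≤ (nonNegative⁻¹ 2ℚ) (<⇒≤ 0<d₁) (<⇒≤ 2<b₁) (<⇒≤ k<d₁′)) b₁d₁<q
    where
    k<d₁′ : ⟦ + k ⟧ < d₁
    k<d₁′ = subst (_< d₁) (i/1≡⟦i⟧ (+ k)) k<d₁
    0<d₁ : 0ℚ < d₁
    0<d₁ = ≤-<-trans (ℕ-mono-≤ {0} {k} ℕ.z≤n) k<d₁′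
    0<d₂ : 0ℚ < d₂
    0<d₂ = <-≤-trans (⟦⟧-mono-< (ℤ.+<+ 1≤s)) (upper⁻ D<d₂)
    0<d₃ : 0ℚ < d₃
    0<d₃ = ≰⇒> λ d₃≤0 → <-irrefl refl (begin-strict
      0ℚ        <⟨ positive⁻¹ 1ℚ ⟩
      1ℚ        <⟨ 1<d₃r ⟩
      d₃ * r    ≤⟨ *-monoʳ-≤ (<⇒≤ 0<r) d₃≤0 ⟩
      0ℚ * r    ≡⟨ *-zeroˡ r ⟩
      0ℚ        ∎)
      where open ≤-Reasoning
    open ≤-Reasoning
    2<b₁ : 2ℚ < b₁
    2<b₁ = begin-strict
      2ℚ * 1ℚ           <⟨ *-monoˡ-< (positive⁻¹ 2ℚ) 1<d₃r ⟩
      2ℚ * (d₃ * r)     ≤⟨ *-monoˡ-≤ (nonNegative⁻¹ 2ℚ) (*-monoˡ-≤ (<⇒≤ 0<d₃) (<⇒≤ (disjoint r<D D<d₂))) ⟩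
      2ℚ * (d₃ * d₂)    ≤⟨ *-monoʳ-≤ (*-nonNeg (<⇒≤ 0<d₃) (<⇒≤ 0<d₂)) (<⇒≤ 2<b₃) ⟩
      b₃ * (d₃ * d₂)    ≡⟨ *-assoc b₃ d₃ d₂ ⟨
      b₃ * d₃ * d₂      <⟨ *-monoʳ-< 0<d₂ b₃d₃<b₂ ⟩
      b₂ * d₂           <⟨ b₂d₂<b₁ ⟩
      b₁                ∎

  -- Since D > 2, the factor 2/D + 2 lies between - 1 and 5.
  upper-[2/D+2]*D*1 : 3 ℕ.≤ s → ∀ {d q} → ⟦ + u ⟧ < d → 2ℚ * (⟦ + 5 ⟧ * d + 1ℚ) < q →
    upper ((fromℕ 2 /ʳ D +ʳ fromℕ 2) *ʳ D *ʳ fromℕ 1) q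
  upper-[2/D+2]*D*1 3≤s {d} {q} u<d Q<q =
    -- The outer box: (2 / D + 2) D lies between - d - 1 and 5 d + 1, and 1 lies between 0 and 2.
    -- The largest corner is 2 (5 d + 1).
    - d - 1ℚ , ⟦ + 5 ⟧ * d + 1ℚ , 0ℚ , 2ℚ ,
    lower-product , upper-product , from-yes (0ℚ <? 1ℚ) , from-yes (1ℚ <? 2ℚ) ,
    subst (_< q) (sym (*-zeroʳ (- d - 1ℚ))) 0<q ,
    <-trans (<-by (⟦ + 12 ⟧ * d + ⟦ + 4 ⟧)
        (+-mono-<-≤ (*-pos (from-yes (0ℚ <? ⟦ + 12 ⟧)) 0<d) (from-yes (0ℚ ≤? ⟦ + 4 ⟧)))
      (solve 1 (λ d → (:- d :- con 1ℚ) :* con 2ℚ :+ (con ⟦ + 12 ⟧ :* d :+ con ⟦ + 4 ⟧)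
                := con 2ℚ :* (con ⟦ + 5 ⟧ :* d :+ con 1ℚ)) refl d)) Q<q ,
    subst (_< q) (sym (*-zeroʳ (⟦ + 5 ⟧ * d + 1ℚ))) 0<q ,
    subst (_< q) (*-comm 2ℚ (⟦ + 5 ⟧ * d + 1ℚ)) Q<q
    where
    1<D : lower D 1ℚ
    1<D = lower⁺ (⟦⟧-mono-< (ℤ.+<+ (ℕ.≤-trans (ℕ.s≤s (ℕ.s≤s ℕ.z≤n)) 3≤s)))
    2<D : lower D 2ℚ
    2<D = lower⁺ (⟦⟧-mono-< (ℤ.+<+ 3≤s))
    D<d : upper D d
    D<d = upper⁺ u<d
    0<d : 0ℚ < d
    0<d = <-trans (positive⁻¹ 1ℚ) (disjoint 1<D D<d)
    0<1+kd : ∀ k .{{_ : NonNegative k}} → 0ℚ < 1ℚ + k * d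
    0<1+kd k = +-mono-<-≤ (positive⁻¹ 1ℚ) (*-nonNeg (nonNegative⁻¹ k) (<⇒≤ 0<d))
    0<q : 0ℚ < q
    0<q = <-trans (*-pos (positive⁻¹ 2ℚ) (subst (0ℚ <_) (+-comm 1ℚ (⟦ + 5 ⟧ * d)) (0<1+kd ⟦ + 5 ⟧))) Q<q
    1/D : Cut
    1/D = cut
      (λ q → ∃[ r ] (0ℚ < r × upper D r × q * r < 1ℚ))
      (λ q → ∃[ r ] (0ℚ < r × lower D r × 1ℚ < q * r))
    0<1/D : lower 1/D 0ℚ
    0<1/D = d , 0<d , D<d , subst (_< 1ℚ) (sym (*-zeroˡ d)) (positive⁻¹ 1ℚ)
    1/D<1 : upper 1/D 1ℚ
    1/D<1 = 2ℚ , positive⁻¹ 2ℚ , 2<D , from-yes (1ℚ <? 1ℚ * 2ℚ)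
    -- Upper bounds are strict, so 9/4 stands for 2; then 2 / D < 5/2, and 5/2 + 9/4 is still below
    -- 5.
    9/4 5/2 : ℚ
    9/4 = + 9 / 4
    5/2 = + 5 / 2
    -1<2/D : lower (fromℕ 2 /ʳ D) (- 1ℚ)
    -1<2/D = 1ℚ , 9/4 , 0ℚ , 1ℚ , from-yes (1ℚ <? 2ℚ) , from-yes (2ℚ <? 9/4) , 0<1/D , 1/D<1 ,
      from-yes (- 1ℚ <? 1ℚ * 0ℚ) , from-yes (- 1ℚ <? 1ℚ * 1ℚ) ,
      from-yes (- 1ℚ <? 9/4 * 0ℚ) , from-yes (- 1ℚ <? 9/4 * 1ℚ)
    2/D<5/2 : upper (fromℕ 2 /ʳ D) 5/2
    2/D<5/2 = 1ℚ , 9/4 , 0ℚ , 1ℚ , from-yes (1ℚ <? 2ℚ) , from-yes (2ℚ <? 9/4) , 0<1/D , 1/D<1 ,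
      from-yes (1ℚ * 0ℚ <? 5/2) , from-yes (1ℚ * 1ℚ <? 5/2) , from-yes (9/4 * 0ℚ <? 5/2) , from-yes (9/4 * 1ℚ <? 5/2)
    -1<2/D+2 : lower (fromℕ 2 /ʳ D +ʳ fromℕ 2) (- 1ℚ)
    -1<2/D+2 = - 1ℚ , 1ℚ , -1<2/D , from-yes (1ℚ <? 2ℚ) , from-yes (- 1ℚ <? - 1ℚ + 1ℚ)
    2/D+2<5 : upper (fromℕ 2 /ʳ D +ʳ fromℕ 2) ⟦ + 5 ⟧
    2/D+2<5 = 5/2 , 9/4 , 2/D<5/2 , from-yes (2ℚ <? 9/4) , from-yes (5/2 + 9/4 <? ⟦ + 5 ⟧)
    lower-product : lower ((fromℕ 2 /ʳ D +ʳ fromℕ 2) *ʳ D) (- d - 1ℚ)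
    lower-product = - 1ℚ , ⟦ + 5 ⟧ , 1ℚ , d , -1<2/D+2 , 2/D+2<5 , 1<D , D<d ,
      <-by d 0<d (solve 1 (λ d → :- d :- con 1ℚ :+ d := con (- 1ℚ)) refl d) ,
      <-by 1ℚ (positive⁻¹ 1ℚ) (solve 1 (λ d → :- d :- con 1ℚ :+ con 1ℚ := con (- 1ℚ) :* d) refl d) ,
      <-by (d + ⟦ + 6 ⟧) (+-mono-<-≤ 0<d (from-yes (0ℚ ≤? ⟦ + 6 ⟧)))
        (solve 1 (λ d → :- d :- con 1ℚ :+ (d :+ con ⟦ + 6 ⟧) := con ⟦ + 5 ⟧) refl d) ,
      <-by (1ℚ + ⟦ + 6 ⟧ * d) (0<1+kd ⟦ + 6 ⟧)
        (solve 1 (λ d → :- d :- con 1ℚ :+ (con 1ℚ :+ con ⟦ + 6 ⟧ :* d) := con ⟦ + 5 ⟧ :* d) refl d)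
    upper-product : upper ((fromℕ 2 /ʳ D +ʳ fromℕ 2) *ʳ D) (⟦ + 5 ⟧ * d + 1ℚ)
    upper-product = - 1ℚ , ⟦ + 5 ⟧ , 1ℚ , d , -1<2/D+2 , 2/D+2<5 , 1<D , D<d ,
      <-by (⟦ + 5 ⟧ * d + 2ℚ)
        (subst (0ℚ <_) (+-comm 2ℚ (⟦ + 5 ⟧ * d))
          (+-mono-<-≤ (positive⁻¹ 2ℚ) (*-nonNeg (nonNegative⁻¹ ⟦ + 5 ⟧) (<⇒≤ 0<d))))
        (solve 1 (λ d → con (- 1ℚ) :+ (con ⟦ + 5 ⟧ :* d :+ con 2ℚ) := con ⟦ + 5 ⟧ :* d :+ con 1ℚ) refl d) ,
      <-by (1ℚ + ⟦ + 6 ⟧ * d) (0<1+kd ⟦ + 6 ⟧)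
        (solve 1 (λ d → con (- 1ℚ) :* d :+ (con 1ℚ :+ con ⟦ + 6 ⟧ :* d) := con ⟦ + 5 ⟧ :* d :+ con 1ℚ) refl d) ,
      <-by (⟦ + 5 ⟧ * (d - 1ℚ) + 1ℚ)
        (subst (0ℚ <_) (+-comm 1ℚ (⟦ + 5 ⟧ * (d - 1ℚ)))
          (+-mono-<-≤ (positive⁻¹ 1ℚ) (*-nonNeg (nonNegative⁻¹ ⟦ + 5 ⟧) 0≤d-1)))
        (solve 1 (λ d → con ⟦ + 5 ⟧ :+ (con ⟦ + 5 ⟧ :* (d :- con 1ℚ) :+ con 1ℚ) := con ⟦ + 5 ⟧ :* d :+ con 1ℚ) refl d) ,
      <-by 1ℚ (positive⁻¹ 1ℚ) refl
      where
      0≤d-1 : 0ℚ ≤ d - 1ℚ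
      0≤d-1 = subst (_≤ d - 1ℚ) (+-inverseʳ 1ℚ) (+-monoˡ-≤ (- 1ℚ) (<⇒≤ (disjoint 1<D D<d)))

-- Deficiency

allVecs-complete : ∀ {xs : List A} → (∀ x → x ∈ xs) → ∀ {m} (v : Vec A m) → v ∈ allVecs xs m
allVecs-complete x∈xs []      = here refl
allVecs-complete x∈xs (x ∷ v) = ∈-cartesianProductWith⁺ _∷_ (x∈xs x) (allVecs-complete x∈xs v)

allΛ-complete : ∀ {b} (w : Λ b) → w ∈ allΛ b
allΛ-complete = allVecs-complete λ { false → here refl ; true → there (here refl) }

length-allVecs-allΛ : ∀ b m → + length (allVecs (allΛ b) m) / 1 ≡ 2^ (+ (b ℕ.* m))
length-allVecs-allΛ b m = begin
  + length (allVecs (allΛ b) m) / 1      ≡⟨ i/1≡⟦i⟧ (+ length (allVecs (allΛ b) m)) ⟩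
  ⟦ + length (allVecs (allΛ b) m) ⟧      ≡⟨ cong (λ k → ⟦ + k ⟧) (length-allVecs (allΛ b) m) ⟩
  ⟦ + (length (allΛ b) ℕ.^ m) ⟧          ≡⟨ cong (λ k → ⟦ + (k ℕ.^ m) ⟧) (length-allΛ b) ⟩
  ⟦ + ((2 ℕ.^ b) ℕ.^ m) ⟧                ≡⟨ cong (λ k → ⟦ + k ⟧) (ℕ.^-*-assoc 2 b m) ⟩
  ⟦ + (2 ℕ.^ (b ℕ.* m)) ⟧                ≡⟨ ⟦2^n⟧ (b ℕ.* m) ⟩
  2^ (+ (b ℕ.* m))                       ∎
  where open ≡-Reasoning

module _ {b m : ℕ} (P : ProbSpace) (V : RV P (Vec (Λ b) m)) where

  maxPr : ℚ
  maxPr = max 0ℚ (List.map (Pr[_] P V) (allVecs (allΛ b) m))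

  0≤maxPr : 0ℚ ≤ maxPr
  0≤maxPr = ⊥≤max 0ℚ (List.map (Pr[_] P V) (allVecs (allΛ b) m))

  maxPr-least : ∀ {p} → 0ℚ ≤ p → (∀ v → Pr[_] P V v ≤ p) → maxPr ≤ p
  maxPr-least {p} 0≤p Pr≤p = max≤v⁺ {v = p} {⊥ = 0ℚ} {xs = List.map (Pr[_] P V) (allVecs (allΛ b) m)} 0≤p
    (All.map⁺ {P = _≤ p} {f = Pr[_] P V} (All.universal Pr≤p (allVecs (allΛ b) m)))

  Pr≤maxPr : ∀ v → Pr[_] P V v ≤ maxPr
  Pr≤maxPr v = All.lookup (xs≤max 0ℚ (List.map (Pr[_] P V) (allVecs (allΛ b) m)))
    (∈-map⁺ (Pr[_] P V) (allVecs-complete allΛ-complete v))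

  D∞-lower⁻ : ∀ {i} → (∀ v → Pr[_] P V v ≤ 2^ i) → ∀ {q} → lower (D∞ P V) q → q < ⟦ + (b ℕ.* m) ℤ.+ i ⟧
  D∞-lower⁻ {i} Pr≤2^i {q} (a , c , a<log , c<log , q<a+c) = begin-strict
    q                                <⟨ q<a+c ⟩
    a + c                            <⟨ +-mono-< a<bm c<i ⟩
    ⟦ + (b ℕ.* m) ⟧ + ⟦ i ⟧          ≡⟨ ⟦⟧-homo-+ (+ (b ℕ.* m)) i ⟩
    ⟦ + (b ℕ.* m) ℤ.+ i ⟧            ∎
    where
    open ≤-Reasoning
    a<bm : a < ⟦ + (b ℕ.* m) ⟧
    a<bm = log-lower⁻ (+ (b ℕ.* m)) {q = a} (2^-nonNeg (+ (b ℕ.* m))) ≤-refl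
      (subst (λ p → lower (log p) a) (length-allVecs-allΛ b m) a<log)
    c<i : c < ⟦ i ⟧
    c<i = log-lower⁻ i {q = c} 0≤maxPr (maxPr-least (2^-nonNeg i) Pr≤2^i)
      (subst (lower (log maxPr)) (solve 1 (λ c → :- (:- c) := c) refl c) c<log)

  -- Cuts are open, so witnesses strictly below b m and i are needed. Taking integer predecessors
  -- costs two bits of deficiency.
  D∞-lower⁺ : ∀ {i} v → 2^ i ≤ Pr[_] P V v → ∀ {q} → q < ⟦ ℤ.pred (+ (b ℕ.* m)) ℤ.+ ℤ.pred i ⟧ → lower (D∞ P V) q
  D∞-lower⁺ {i} v 2^i≤Pr {q} q< = a , c ,
    subst (λ p → lower (log p) a) (sym (length-allVecs-allΛ b m))
      (log-lower⁺ (+ (b ℕ.* m)) {q = a} ≤-refl (⟦⟧-mono-< (pred< (+ (b ℕ.* m))))) ,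
    subst (lower (log maxPr)) (solve 1 (λ c → c := :- (:- c)) refl c)
      (log-lower⁺ i {q = c} (≤-trans 2^i≤Pr (Pr≤maxPr v)) (⟦⟧-mono-< (pred< i))) ,
    subst (q <_) (sym (⟦⟧-homo-+ (ℤ.pred (+ (b ℕ.* m))) (ℤ.pred i))) q<
    where
    pred< : ∀ i → ℤ.pred i ℤ.< i
    pred< i = ℤ.i≤pred[j]⇒i<j ℤ.≤-refl
    a c : ℚ
    a = ⟦ ℤ.pred (+ (b ℕ.* m)) ⟧
    c = ⟦ ℤ.pred i ⟧

-- Sparsity

module _ {b : ℕ} {g : Gadget b} {s u : ℕ} (Δ-bounds : Δ g isBetween s and u) where

  -- Each block loses at most one bit, so the deficiency is at most |S|, while (2 / Δ) Δ |S| allows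
  -- twice as much.
  sparse : 1 ℕ.≤ s → ∀ {n} (P : ProbSpace) (V : RV P (Vec (Λ b) n)) →
    (∀ S v → Pr[_] P (λ ω → project S (V ω)) v ≤ (2ℚ * ½ ^ b) ^ card S) → Sparse g (fromℕ 2 /ʳ Δ g) P V
  sparse 1≤s P V spread S (q , σ<q , q<D∞) = <-irrefl refl (begin-strict
    q
      <⟨ D∞-lower⁻ P (λ ω → project S (V ω)) {i = i}
         (λ v → subst (Pr[_] P (λ ω → project S (V ω)) v ≤_) p^k≡2^i (spread S v)) q<D∞ ⟩
    ⟦ + (b ℕ.* k) ℤ.+ i ⟧               ≡⟨ cong ⟦_⟧ bk+i≡k ⟩
    ⟦ + k ⟧                             ≡⟨ +-identityʳ ⟦ + k ⟧ ⟨
    ⟦ + k ⟧ + 0ℚ                        ≤⟨ +-monoʳ-≤ ⟦ + k ⟧ (ℕ-mono-≤ {0} {k} ℕ.z≤n) ⟩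
    ⟦ + k ⟧ + ⟦ + k ⟧                   ≡⟨ solve 1 (λ p → p :+ p := con 2ℚ :* p) refl ⟦ + k ⟧ ⟩
    2ℚ * ⟦ + k ⟧                        <⟨ upper-2/D*D*k Δ-bounds 1≤s k σ<q ⟩
    q                                   ∎)
    where
    open ≤-Reasoning
    k : ℕ
    k = card S
    i : ℤ
    i = ℤ.suc (ℤ.- (+ b)) ℤ.* + k
    p^k≡2^i : (2ℚ * ½ ^ b) ^ k ≡ 2^ i
    p^k≡2^i = trans (cong (_^ k) (trans (cong (2ℚ *_) (sym (2^-neg b))) (sym (2^-suc (ℤ.- (+ b))))))
      (2^-homo-^ (ℤ.suc (ℤ.- (+ b))) k)
    bk+i≡k : + (b ℕ.* k) ℤ.+ i ≡ + k
    bk+i≡k = trans (cong (ℤ._+ i) (ℤ.pos-* b k)) (identity (+ b) (+ k))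
      where
      identity : ∀ b k → b ℤ.* k ℤ.+ (+ 1 ℤ.+ ℤ.- b) ℤ.* k ≡ k
      identity = ℤ.solve-∀

  not-sparse : 3 ℕ.≤ s → u ≡ suc (s ℕ.+ s) → ∀ {n} (P : ProbSpace) (V : RV P (Vec (Λ b) n)) S → card S ≡ 1 →
    ∀ v → 2^ (+ (30 ℕ.* s) ℤ.- + b) ≤ Pr[_] P (λ ω → project S (V ω)) v →
    ¬ Sparse g (fromℕ 2 /ʳ Δ g +ʳ fromℕ 2) P V
  not-sparse 3≤s u≡1+2s P V S ∣S∣≡1 v likely V-sparse = V-sparse S (q ,
    subst (λ k → upper ((fromℕ 2 /ʳ Δ g +ʳ fromℕ 2) *ʳ Δ g *ʳ fromℕ k) q) (sym ∣S∣≡1)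
      (upper-[2/D+2]*D*1 Δ-bounds 3≤s {d = d} u<d bound<q) ,
    D∞-lower⁺ P (λ ω → project S (V ω)) {i = + (30 ℕ.* s) ℤ.- + b} v likely q<D∞)
    where
    -- Here d = u + 1, and q separates the threshold from the deficiency: 2 (5 d + 1) = 20 s + 22 <
    -- q ≤ 30 s - 3 < 30 s - 2. The middle inequality is where 3 ≤ s is used.
    q d : ℚ
    q = ⟦ + (20 ℕ.* s ℕ.+ 23) ⟧
    d = ⟦ + (2 ℕ.* s ℕ.+ 2) ⟧
    u<d : ⟦ + u ⟧ < d
    u<d = ⟦⟧-mono-< (ℤ.+<+ (ℕ.≤-reflexive (trans (cong suc u≡1+2s) (eq s))))
      where
      eq : ∀ s → suc (suc (s ℕ.+ s)) ≡ 2 ℕ.* s ℕ.+ 2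
      eq = solve-∀
    bound<q : 2ℚ * (⟦ + 5 ⟧ * d + 1ℚ) < q
    bound<q = begin-strict
      2ℚ * (⟦ + 5 ⟧ * d + 1ℚ)                              ≡⟨ cong (λ p → 2ℚ * (p + 1ℚ)) (⟦m*n⟧ 5 (2 ℕ.* s ℕ.+ 2)) ⟩
      2ℚ * (⟦ + (5 ℕ.* (2 ℕ.* s ℕ.+ 2)) ⟧ + 1ℚ)
        ≡⟨ cong (2ℚ *_) (⟦⟧-homo-+ (+ (5 ℕ.* (2 ℕ.* s ℕ.+ 2))) (+ 1)) ⟩
      2ℚ * ⟦ + (5 ℕ.* (2 ℕ.* s ℕ.+ 2) ℕ.+ 1) ⟧             ≡⟨ ⟦m*n⟧ 2 (5 ℕ.* (2 ℕ.* s ℕ.+ 2) ℕ.+ 1) ⟩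
      ⟦ + (2 ℕ.* (5 ℕ.* (2 ℕ.* s ℕ.+ 2) ℕ.+ 1)) ⟧          <⟨ ⟦⟧-mono-< (ℤ.+<+ (ℕ.≤-reflexive (eq s))) ⟩
      q                                                    ∎
      where
      open ≤-Reasoning
      eq : ∀ s → suc (2 ℕ.* (5 ℕ.* (2 ℕ.* s ℕ.+ 2) ℕ.+ 1)) ≡ 20 ℕ.* s ℕ.+ 23
      eq = solve-∀
    q<D∞ : q < ⟦ ℤ.pred (+ (b ℕ.* card S)) ℤ.+ ℤ.pred (+ (30 ℕ.* s) ℤ.- + b) ⟧
    q<D∞ = subst (λ i → q < ⟦ i ⟧) (sym exponent) (⟦⟧-mono-< (ℤ.i≤pred[j]⇒i<j
      (subst (+ (20 ℕ.* s ℕ.+ 23) ℤ.≤_) 30s-3 (ℤ.+≤+ (ℕ.m+n≤o⇒m≤o∸n (20 ℕ.* s ℕ.+ 23) 20s+26≤30s)))))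
      where
      20s+26≤30s : 20 ℕ.* s ℕ.+ 23 ℕ.+ 3 ℕ.≤ 30 ℕ.* s
      20s+26≤30s = begin
        20 ℕ.* s ℕ.+ 23 ℕ.+ 3       ≡⟨ ℕ.+-assoc (20 ℕ.* s) 23 3 ⟩
        20 ℕ.* s ℕ.+ 26             ≤⟨ ℕ.+-monoʳ-≤ (20 ℕ.* s) (ℕ.≤-trans (ℕ.m≤m+n 26 4) (ℕ.*-monoʳ-≤ 10 3≤s)) ⟩
        20 ℕ.* s ℕ.+ 10 ℕ.* s       ≡⟨ ℕ.*-distribʳ-+ s 20 10 ⟨
        30 ℕ.* s                    ∎
        where open ℕ.≤-Reasoning
      30s-3 : + (30 ℕ.* s ℕ.∸ 3) ≡ ℤ.pred (ℤ.pred (ℤ.pred (+ (30 ℕ.* s))))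
      30s-3 = trans (sym (ℤ.⊖-≥ (ℕ.≤-trans (ℕ.m≤n+m 3 (20 ℕ.* s ℕ.+ 23)) 20s+26≤30s)))
        (trans (sym (ℤ.m-n≡m⊖n (30 ℕ.* s) 3)) (eq (+ (30 ℕ.* s))))
        where
        eq : ∀ i → i ℤ.- + 3 ≡ ℤ.- + 1 ℤ.+ (ℤ.- + 1 ℤ.+ (ℤ.- + 1 ℤ.+ i))
        eq = ℤ.solve-∀
      exponent : ℤ.pred (+ (b ℕ.* card S)) ℤ.+ ℤ.pred (+ (30 ℕ.* s) ℤ.- + b) ≡ ℤ.pred (ℤ.pred (+ (30 ℕ.* s)))
      exponent = trans (cong (λ k → ℤ.pred (+ k) ℤ.+ ℤ.pred (+ (30 ℕ.* s) ℤ.- + b))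
          (trans (cong (b ℕ.*_) ∣S∣≡1) (ℕ.*-identityʳ b)))
        (eq (+ b) (+ (30 ℕ.* s)))
        where
        eq : ∀ b i → (ℤ.- + 1 ℤ.+ b) ℤ.+ (ℤ.- + 1 ℤ.+ (i ℤ.- b)) ≡ ℤ.- + 1 ℤ.+ (ℤ.- + 1 ℤ.+ i)
        eq = ℤ.solve-∀

-- Negation exchanges the halves of the cut, so the upper bound ½ ^ s on the discrepancy bounds Δ
-- from below, and the lower bound ½ ^ (2 s + 1) bounds it from above.
Δ-bounds : ∀ s b → s ℕ.+ s ℕ.≤ b → Δ {suc b} (gadget (s ℕ.+ s)) isBetween s and suc (s ℕ.+ s)
Δ-bounds s b 2s≤b = record
  { lower⁺   = λ {q} q<s → log-upper⁺ (ℤ.- (+ s)) {q = - q} (<⇒≤ 0<disc)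
      (subst (disc g ≤_) (sym (2^-neg s)) (disc≤ s b 2s≤b))
      (subst (_< - q) (⟦⟧-homo-neg (+ s)) (neg-antimono-< q<s))
  ; upper⁺   = λ {q} u<q → log-lower⁺ (ℤ.- (+ suc (s ℕ.+ s))) {q = - q}
      (subst (_≤ disc g) (sym (2^-neg (suc (s ℕ.+ s)))) (≤disc (s ℕ.+ s) b 2s≤b))
      (subst (- q <_) (⟦⟧-homo-neg (+ suc (s ℕ.+ s))) (neg-antimono-< u<q))
  ; disjoint = λ {q} {r} q<Δ Δ<r → neg-cancel-< (log-disjoint {q = - r} {r = - q} 0<disc Δ<r q<Δ)
  }
  where
  g : Gadget (suc b)
  g = gadget (s ℕ.+ s)
  0<disc : 0ℚ < disc g
  0<disc = <-≤-trans (^-pos (suc (s ℕ.+ s)) (positive⁻¹ ½)) (≤disc (s ℕ.+ s) b 2s≤b)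
  neg-cancel-< : ∀ {p q} → - q < - p → p < q
  neg-cancel-< {p} {q} -q<-p = subst₂ _<_ (solve 1 (λ p → :- (:- p) := p) refl p)
    (solve 1 (λ p → :- (:- p) := p) refl q)
    (neg-antimono-< -q<-p)

-- The random variables

-- Words have `suc b` bits and vectors `suc n` blocks: the extra bit is y₀, and the extra block is
-- the one that holds the equations.
module Construction (s b n : ℕ) (3≤s : 3 ℕ.≤ s) (2s≤b : s ℕ.+ s ℕ.≤ b)
  (m≤n : 30 ℕ.* s ℕ.≤ n) (m[1+t]≤1+b : 30 ℕ.* s ℕ.* suc (s ℕ.+ s) ℕ.≤ suc b) where

  t k : ℕ
  t = s ℕ.+ s
  k = 30 ℕ.* s

  g : Gadget (suc b)
  g = gadget t

  Δg : Δ g isBetween s and suc (s ℕ.+ s)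
  Δg = Δ-bounds s b 2s≤b

  1≤s : 1 ℕ.≤ s
  1≤s = ℕ.≤-trans (ℕ.s≤s ℕ.z≤n) 3≤s

  blocks : List (Vec (Λ (suc b)) (suc n))
  blocks = allVecs (allΛ (suc b)) (suc n)

  blocks-nonZero : ℕ.NonZero (length blocks)
  blocks-nonZero = allVecs-nonZero (allΛ (suc b)) (suc n) {{allΛ-nonZero (suc b)}}

  respond : Vec (Λ (suc b)) (suc n) → Vec (Λ (suc b)) (suc n)
  respond = run (out t) (next t) nothing

  P : ProbSpace
  P = pairSpace blocks blocks {{blocks-nonZero}} {{blocks-nonZero}}

  X Y : RV P (Vec (Λ (suc b)) (suc n))
  X ω = first blocks blocks {{blocks-nonZero}} {{blocks-nonZero}} ω
  Y ω = respond (second blocks blocks {{blocks-nonZero}} {{blocks-nonZero}} ω)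

  Pr-X : ∀ e → Pr P (λ ω → e (X ω)) ≡ mean blocks (ind ∘ e)
  Pr-X = Pr-first blocks blocks {{blocks-nonZero}} {{blocks-nonZero}}

  Pr-Y : ∀ e → Pr P (λ ω → e (Y ω)) ≡ mean blocks (ind ∘ e ∘ respond)
  Pr-Y e = Pr-second blocks blocks {{blocks-nonZero}} {{blocks-nonZero}} (e ∘ respond)

  X⊥Y : Independent P X Y
  X⊥Y x y = trans
    (Pr-first∧second blocks blocks {{blocks-nonZero}} {{blocks-nonZero}}
      (λ v → does (v ≟ˢ x)) (λ w → does (respond w ≟ˢ y)))
    (sym (cong₂ _*_ Pr[X≡x] Pr[Y≡y]))
    where
    Pr[X≡x] : Pr[_] P X x ≡ mean blocks (λ v → ind (does (v ≟ˢ x)))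
    Pr[X≡x] = Pr-X (λ v → does (v ≟ˢ x))
    Pr[Y≡y] : Pr[_] P Y y ≡ mean blocks (λ w → ind (does (respond w ≟ˢ y)))
    Pr[Y≡y] = Pr-Y (λ w → does (w ≟ˢ y))

  0≤2½^b : 0ℚ ≤ 2ℚ * ½ ^ suc b
  0≤2½^b = *-nonNeg (nonNegative⁻¹ 2ℚ) (^-nonNeg (suc b) (nonNegative⁻¹ ½))

  X-sparse : Sparse g (fromℕ 2 /ʳ Δ g) P X
  X-sparse = sparse {g = g} Δg 1≤s P X spread
    where
    spread : ∀ S v → Pr[_] P (λ ω → project S (X ω)) v ≤ (2ℚ * ½ ^ suc b) ^ card S
    spread S v = ≤-trans (≤-reflexive eq)
      (run-project≤ (λ _ w → w) (λ _ _ → tt) 0≤2½^b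
        (λ _ u → ≤-trans (≤-reflexive (mean-≟ (suc b) u)) (½^b≤2½^b (suc b))) tt S v)
      where
      eq : Pr[_] P (λ ω → project S (X ω)) v ≡
        mean blocks (λ x → ind (does (project S (run (λ _ w → w) (λ _ _ → tt) tt x) ≟ˢ v)))
      eq = trans (Pr-X (λ x → does (project S x ≟ˢ v)))
        (mean-cong blocks (λ x → cong (λ x → ind (does (project S x ≟ˢ v))) (sym (run-id x))))

  Y-sparse : Sparse g (fromℕ 2 /ʳ Δ g) P Y
  Y-sparse = sparse {g = g} Δg 1≤s P Y spread
    where
    spread : ∀ S v → Pr[_] P (λ ω → project S (Y ω)) v ≤ (2ℚ * ½ ^ suc b) ^ card S
    spread S v = ≤-trans (≤-reflexive eq)
      (run-project≤ (out t) (next t) 0≤2½^b (out-spread t) nothing S v)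
      where
      eq : Pr[_] P (λ ω → project S (Y ω)) v ≡ mean blocks (λ w → ind (does (project S (respond w) ≟ˢ v)))
      eq = Pr-Y (λ y → does (project S y ≟ˢ v))

  I : Subset (suc n)
  I = outside ∷ initial k n

  -- Among the blocks outside `I`, just the one that holds the equations.
  S : Subset (card (∁ I))
  S = inside ∷ ⊥

  dangerous : ∀ x → Dangerous g P Y (fromℕ 2 /ʳ Δ g) (fromℕ 2) x
  dangerous (x₀ ∷ xs) = inj₂ (I , z , E-pos ,
      not-sparse {g = g} Δg 3≤s refl
        (condition P E E-pos) (λ ω → project (∁ I) (Y ω)) S
      (cong suc (∣⊥∣≡0 (card (∁ (initial k n))))) y₀ likely)
    where
    answers : Vec (Λ (suc b)) (suc n) → Vec Bool (card (initial k n))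
    answers y = zipWith g (project I (x₀ ∷ xs)) (project I y)
    -- Only an upper bound on the probability is asked for, because a rarer event magnifies more.
    -- That it is positive follows from `block`.
    rare-answer : ∃[ z ]
      mean blocks (λ w → 1ℚ * ind (does (answers (respond w) ≟ᵇ z)))
        ≤ ½ ^ card (initial k n) * mean blocks (λ _ → 1ℚ)
    rare-answer = unlikely-value blocks (answers ∘ respond) (λ _ → 1ℚ)
    z : Vec Bool (card (initial k n))
    z = proj₁ rare-answer
    E : Event P
    E = gᴵ≡ g P Y (x₀ ∷ xs) I z
    Pr-E≤ : Pr P E ≤ ½ ^ k
    Pr-E≤ = begin
      Pr P E
        ≡⟨ Pr-Y (λ y → does (answers y ≟ᵇ z)) ⟩
      mean blocks (λ w → ind (does (answers (respond w) ≟ᵇ z)))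
        ≡⟨ mean-cong blocks (λ w → *-identityˡ (ind (does (answers (respond w) ≟ᵇ z)))) ⟨
      mean blocks (λ w → 1ℚ * ind (does (answers (respond w) ≟ᵇ z)))
        ≤⟨ proj₂ rare-answer ⟩
      ½ ^ card (initial k n) * mean blocks (λ _ → 1ℚ)
        ≡⟨ cong₂ (λ k p → ½ ^ k * p) (card-initial m≤n) (mean-const blocks {{blocks-nonZero}} 1ℚ) ⟩
      ½ ^ k * 1ℚ
        ≡⟨ *-identityʳ (½ ^ k) ⟩
      ½ ^ k
        ∎
      where open ≤-Reasoning
    block : Σ[ v ∈ Λ (suc b) ] (∀ ws → answers (respond (v ∷ ws)) ≡ z)
    block = solving-block t 2s≤b k m[1+t]≤1+b xs z
    v : Λ (suc b)
    v = proj₁ block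
    -- Only the first block survives the projection to `S`; the copies of `v` behind it are filler.
    y₀ : Vec (Λ (suc b)) (card S)
    y₀ = project S (project (∁ I) (v ∷ Vec.replicate n v))
    F : Event P
    F ω = does (project S (project (∁ I) (Y ω)) ≟ˢ y₀)
    both : Vec (Λ (suc b)) (suc n) → Bool
    both w = does (answers (respond w) ≟ᵇ z) ∧ does (project S (project (∁ I) (respond w)) ≟ˢ y₀)
    both-v : ∀ ws → both (v ∷ ws) ≡ true
    both-v ws = cong₂ _∧_ (dec-true (answers (respond (v ∷ ws)) ≟ᵇ z) (proj₂ block ws))
      (dec-true (project S (project (∁ I) (respond (v ∷ ws))) ≟ˢ y₀)
        (cong (v ∷_) (⊥-vec-unique (card (∁ (initial k n))) _ _)))
    -- Once the first block is `v`, both events hold for every continuation, so the full mass of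
    -- that block counts.
    hit≤both : ∀ w₀ (d : Dec (w₀ ≡ v)) → ind (does d) ≤ mean (allVecs (allΛ (suc b)) n) (λ ws → ind (both (w₀ ∷ ws)))
    hit≤both w₀ (no _)     = mean-nonNeg (allVecs (allΛ (suc b)) n) (λ ws → ind-nonNeg (both (w₀ ∷ ws)))
    hit≤both w₀ (yes refl) = ≤-reflexive (sym (trans
      (mean-cong (allVecs (allΛ (suc b)) n) (λ ws → cong ind (both-v ws)))
      (mean-const (allVecs (allΛ (suc b)) n) {{allVecs-nonZero (allΛ (suc b)) n {{allΛ-nonZero (suc b)}}}} 1ℚ)))
    ½^b≤Pr-E∧F : ½ ^ suc b ≤ Pr P (λ ω → E ω ∧ F ω)
    ½^b≤Pr-E∧F = begin
      ½ ^ suc b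
        ≡⟨ mean-≟ (suc b) v ⟨
      mean (allΛ (suc b)) (λ w₀ → ind (does (w₀ ≟ᵇ v)))
        ≤⟨ mean-mono (allΛ (suc b)) (λ w₀ → hit≤both w₀ (w₀ ≟ᵇ v)) ⟩
      mean (allΛ (suc b)) (λ w₀ → mean (allVecs (allΛ (suc b)) n) (λ ws → ind (both (w₀ ∷ ws))))
        ≡⟨ mean-allVecs (allΛ (suc b)) n (ind ∘ both) ⟨
      mean blocks (ind ∘ both)
        ≡⟨ Pr-Y (λ y → does (answers y ≟ᵇ z) ∧ does (project S (project (∁ I) y) ≟ˢ y₀)) ⟨
      Pr P (λ ω → E ω ∧ F ω)
        ∎
      where open ≤-Reasoning
    Pr-E∧F≤Pr-E : Pr P (λ ω → E ω ∧ F ω) ≤ Pr P E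
    Pr-E∧F≤Pr-E = subst₂ _≤_
      (sym (Pr-Y (λ y → does (answers y ≟ᵇ z) ∧ does (project S (project (∁ I) y) ≟ˢ y₀))))
      (sym (Pr-Y (λ y → does (answers y ≟ᵇ z))))
      (mean-mono blocks (λ w → ∧≤ (does (answers (respond w) ≟ᵇ z)) _))
      where
      ∧≤ : ∀ a c → ind (a ∧ c) ≤ ind a
      ∧≤ true  c = ind≤1 c
      ∧≤ false c = ≤-refl
    E-pos : 0ℚ < Pr P E
    E-pos = <-≤-trans (^-pos (suc b) (positive⁻¹ ½)) (≤-trans ½^b≤Pr-E∧F Pr-E∧F≤Pr-E)
    likely : 2^ (+ k ℤ.- + suc b) ≤ Pr (condition P E E-pos) F
    likely = *-cancelˡ-≤ E-pos (begin
      Pr P E * 2^ (+ k ℤ.- + suc b)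
        ≤⟨ *-monoʳ-≤ (2^-nonNeg (+ k ℤ.- + suc b)) Pr-E≤ ⟩
      ½ ^ k * 2^ (+ k ℤ.- + suc b)
        ≡⟨ cong (_* 2^ (+ k ℤ.- + suc b)) (2^-neg k) ⟨
      2^ (ℤ.- (+ k)) * 2^ (+ k ℤ.- + suc b)
        ≡⟨ 2^-homo-+ (ℤ.- (+ k)) (+ k ℤ.- + suc b) ⟨
      2^ (ℤ.- (+ k) ℤ.+ (+ k ℤ.- + suc b))
        ≡⟨ cong 2^_ (eq (+ k) (+ suc b)) ⟩
      2^ (ℤ.- (+ suc b))
        ≡⟨ 2^-neg (suc b) ⟩
      ½ ^ suc b
        ≤⟨ ½^b≤Pr-E∧F ⟩
      Pr P (λ ω → E ω ∧ F ω)
        ≡⟨ Pr-condition P E F E-pos ⟨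
      Pr (condition P E E-pos) F * Pr P E
        ≡⟨ *-comm (Pr (condition P E E-pos) F) (Pr P E) ⟩
      Pr P E * Pr (condition P E E-pos) F
        ∎)
      where
      open ≤-Reasoning
      eq : ∀ i j → ℤ.- i ℤ.+ (i ℤ.- j) ≡ ℤ.- j
      eq = ℤ.solve-∀

-- The choice of s

opaque
  -- This is s = ⌊√b / 10⌋, found by counting up: when b grows by one, s grows by at most one.
  scaled-√ : ∀ b → ∃[ s ] (100 ℕ.* (s ℕ.* s) ℕ.≤ b × b ℕ.< 100 ℕ.* (suc s ℕ.* suc s))
  scaled-√ zero = 0 , ℕ.z≤n , ℕ.s≤s ℕ.z≤n
  scaled-√ (suc b) with scaled-√ b
  ... | s , 100s²≤b , b<100[1+s]² with suc b ℕ.<? 100 ℕ.* (suc s ℕ.* suc s)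
  ... | yes 1+b< = s , ℕ.m≤n⇒m≤1+n 100s²≤b , 1+b<
  ... | no  1+b≮ = suc s , ℕ.≮⇒≥ 1+b≮ ,
    ℕ.≤-<-trans b<100[1+s]² (ℕ.*-monoʳ-< 100 (ℕ.*-mono-< (ℕ.n<1+n (suc s)) (ℕ.n<1+n (suc s))))

module _ {b s : ℕ} (100s²≤b : 100 ℕ.* (s ℕ.* s) ℕ.≤ b) where

  -- Otherwise s + 1 ≤ 3 and b < 900.
  3≤s : 1000 ℕ.≤ b → b ℕ.< 100 ℕ.* (suc s ℕ.* suc s) → 3 ℕ.≤ s
  3≤s 1000≤b b<100[1+s]² = ℕ.≮⇒≥ λ s<3 → ℕ.<-irrefl refl (ℕ.<-≤-trans b<100[1+s]²
    (ℕ.≤-trans (ℕ.*-monoʳ-≤ 100 (ℕ.*-mono-≤ s<3 s<3)) (ℕ.≤-trans (ℕ.m≤m+n 900 100) 1000≤b)))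

  1+2s≤3s : 3 ℕ.≤ s → suc (s ℕ.+ s) ℕ.≤ 3 ℕ.* s
  1+2s≤3s 3≤s = ℕ.≤-trans (ℕ.+-monoˡ-≤ (s ℕ.+ s) (ℕ.≤-trans (ℕ.s≤s ℕ.z≤n) 3≤s))
    (ℕ.≤-reflexive (cong (λ k → s ℕ.+ (s ℕ.+ k)) (sym (ℕ.+-identityʳ s))))

  1+2s≤b : 3 ℕ.≤ s → suc (s ℕ.+ s) ℕ.≤ b
  1+2s≤b 3≤s = begin
    suc (s ℕ.+ s)         ≤⟨ 1+2s≤3s 3≤s ⟩
    3 ℕ.* s               ≤⟨ ℕ.*-monoˡ-≤ s 3≤s ⟩
    s ℕ.* s               ≤⟨ ℕ.m≤n*m (s ℕ.* s) 100 ⟩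
    100 ℕ.* (s ℕ.* s)     ≤⟨ 100s²≤b ⟩
    b                     ∎
    where open ℕ.≤-Reasoning

  30s[1+2s]≤b : 3 ℕ.≤ s → 30 ℕ.* s ℕ.* suc (s ℕ.+ s) ℕ.≤ b
  30s[1+2s]≤b 3≤s = begin
    30 ℕ.* s ℕ.* suc (s ℕ.+ s)    ≤⟨ ℕ.*-monoʳ-≤ (30 ℕ.* s) (1+2s≤3s 3≤s) ⟩
    30 ℕ.* s ℕ.* (3 ℕ.* s)        ≡⟨ eq s ⟩
    90 ℕ.* (s ℕ.* s)              ≤⟨ ℕ.*-monoˡ-≤ (s ℕ.* s) (ℕ.m≤m+n 90 10) ⟩
    100 ℕ.* (s ℕ.* s)             ≤⟨ 100s²≤b ⟩
    b                             ∎
    where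
    open ℕ.≤-Reasoning
    eq : ∀ s → 30 ℕ.* s ℕ.* (3 ℕ.* s) ≡ 90 ℕ.* (s ℕ.* s)
    eq = solve-∀

  -- Since 30 s ≤ 3 √b < k + 1 ≤ n, there is room for 30 s blocks besides the first.
  30s≤⌊3√b⌋ : ∀ {k} → k IsFloorOf (fromℕ 3 *ʳ (√ b)) → 30 ℕ.* s ℕ.< k ℕ.+ 1
  30s≤⌊3√b⌋ {k} (_ , q , 3√b<q , q<k+1) = ℤ.drop‿+<+ (⟦⟧-cancel-< (begin-strict
    ⟦ + (30 ℕ.* s) ⟧               ≡⟨ cong (λ i → ⟦ + i ⟧) (ℕ.*-assoc 3 10 s) ⟩
    ⟦ + (3 ℕ.* (10 ℕ.* s)) ⟧       ≡⟨ ⟦m*n⟧ 3 (10 ℕ.* s) ⟨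
    ⟦ + 3 ⟧ * ⟦ + (10 ℕ.* s) ⟧     <⟨ upper-*√ {s = s} 100s²≤b (nonNegative⁻¹ ⟦ + 3 ⟧) 3√b<q ⟩
    q                              <⟨ q<k+1 ⟩
    + (k ℕ.+ 1) / 1                ≡⟨ i/1≡⟦i⟧ (+ (k ℕ.+ 1)) ⟩
    ⟦ + (k ℕ.+ 1) ⟧                ∎))
    where open ≤-Reasoning

proposition6p2 : Σ[ c ∈ ℚ ] Σ[ C ∈ ℚ ] (0ℚ < c × 0ℚ < C ×
    ((b n k : ℕ) → 1000 ℕ.≤ b → k IsFloorOf (fromℕ 3 *ʳ (√ b)) → k ℕ.+ 1 ℕ.≤ n →
    Σ[ g ∈ Gadget b ]
    ( fromℚ c *ʳ (√ b) ≤ʳ Δ g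
    × Δ g ≤ʳ fromℚ C *ʳ (√ b)
    × Σ[ P ∈ ProbSpace ] Σ[ X ∈ RV P (Vec (Λ b) n) ] Σ[ Y ∈ RV P (Vec (Λ b) n) ]
    ( Independent P X Y
    × Sparse g (fromℕ 2 /ʳ Δ g) P X
    × Sparse g (fromℕ 2 /ʳ Δ g) P Y
    × (∀ x → _∈supp P X x → Dangerous g P Y (fromℕ 2 /ʳ Δ g) (fromℕ 2) x)))))
proposition6p2 = 1/20 , 1ℚ , positive⁻¹ 1/20 , positive⁻¹ 1ℚ , λ
  { zero    n       k ()
  ; (suc b) zero    k _ _ k+1≤0 → contradiction (ℕ.≤-trans (ℕ.m≤n+m 1 k) k+1≤0) λ ()
  ; (suc b) (suc n) k 1000≤b floor k+1≤n →
      let s , 100s²≤b , b<100[1+s]² = scaled-√ (suc b)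
          s≥3 = 3≤s {s = s} 100s²≤b 1000≤b b<100[1+s]²
          1+2s≤10s = ℕ.≤-trans (1+2s≤3s {s = s} 100s²≤b s≥3) (ℕ.*-monoˡ-≤ s (ℕ.m≤m+n 3 7))
          open Construction s b n s≥3 (ℕ.s≤s⁻¹ (1+2s≤b {s = s} 100s²≤b s≥3))
            (ℕ.s≤s⁻¹ (ℕ.≤-trans (30s≤⌊3√b⌋ {s = s} 100s²≤b {k} floor) k+1≤n)) (30s[1+2s]≤b {s = s} 100s²≤b s≥3)
      in g , √b/20≤D {D = Δ g} Δg 1≤s b<100[1+s]² , D≤√b {D = Δ g} Δg 1+2s≤10s 100s²≤b ,
         P , X , Y , X⊥Y , X-sparse , Y-sparse , λ x _ → dangerous x
  }
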